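{- Let $a$ and $x$ be real numbers and $m$ a positive integer. Then for all $z$ in a sufficiently small neighbourhood of $0$ (depending on $a$, $m$ and $x$), $$\sum_{n=0}^{\infty}\widetilde{F}_{m,a}(n;x)\frac{z^n}{n!}=\int_{0}^{\infty}\exp\left[-az-\lambda\left(1-\frac{x}{m}\left(e^{mz}-1\right)\right)\right]d\lambda.$$
   Context: For a real number $a$, a positive integer $m$ and integers $n,k\ge 0$, the noncentral Whitney numbers of the second kind are given by $$\widetilde{W}_{m,a}(n,k)=\frac{1}{m^k k!}\sum_{j=0}^{k}\binom{k}{j}(-1)^{k-j}(mj-a)^n,$$ with the convention $0^0=1$. The noncentral Tanny-Dowling polynomials are $$\widetilde{F}_{m,a}(n;x)=\sum_{k=0}^{n}k!\,\widetilde{W}_{m,a}(n,k)\,x^k.$$ -}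

module Defs where

open import Algebra.Bundles.Raw using (RawRing; RawSemiring)
import Algebra.Definitions.RawSemiring as SemiringDefs
open import Data.Fin.Base using (Fin; inject₁; fromℕ)
open import Data.Integer.Base as ℤ using (ℤ; +_)
import Data.Integer.Properties as ℤₚ
open import Data.Nat.Base as ℕ using (ℕ; zero; suc; NonZero; _∸_; _!)
open import Data.Nat.Combinatorics using (_C_)
import Data.Nat.Properties as ℕₚ
open import Data.Product.Base using (Σ-syntax; ∃-syntax; _×_; _,_; proj₁; proj₂)
open import Data.Rational.Base as ℚ using (ℚ; mkℚ; 0ℚ; 1ℚ; ½) hiding (module ℚ)
import Data.Rational.Properties as ℚₚ
open import Data.Rational.Solver using (module +-*-Solver)
import Data.Rational.Unnormalised.Base as ℚᵘ
import Data.Rational.Unnormalised.Properties as ℚᵘₚ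
open import Data.Sum.Base using (_⊎_; inj₁; inj₂)
open import Level using (0ℓ)
open import Relation.Binary.PropositionalEquality.Core
  using (_≡_; refl; sym; trans; cong; cong₂; subst)

module FiniteSums (R : RawSemiring 0ℓ 0ℓ) where
  open RawSemiring R using (Carrier; _+_)

  infix 5 ∑≤

  -- The upper limit is included: ∑[ k ≤ n ] f k = f 0 + … + f n.
  ∑≤ : ℕ → (ℕ → Carrier) → Carrier
  ∑≤ zero    f = f 0
  ∑≤ (suc n) f = ∑≤ n f + f (suc n)

  syntax ∑≤ n (λ k → e) = ∑[ k ≤ n ] e

module Rational where
  open ℚ
  open ℚₚ
  open SemiringDefs +-*-rawSemiring using (_^_)
  open FiniteSums +-*-rawSemiring

  ℕ⇒ℚ : ℕ → ℚ
  ℕ⇒ℚ n = + n / 1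

  ℕ⇒ℚ-nonNeg : ∀ n → NonNegative (ℕ⇒ℚ n)
  ℕ⇒ℚ-nonNeg n = normalize-nonNeg n 1

  0≤ℕ⇒ℚ : ∀ n → 0ℚ ≤ ℕ⇒ℚ n
  0≤ℕ⇒ℚ n = nonNegative⁻¹ (ℕ⇒ℚ n) {{ℕ⇒ℚ-nonNeg n}}

  toℚᵘ-/ : ∀ n d .{{_ : ℕ.NonZero d}} → toℚᵘ (n / d) ℚᵘ.≃ (n ℚᵘ./ d)
  toℚᵘ-/ n (suc d) = toℚᵘ-fromℚᵘ (ℚᵘ.mkℚᵘ n d)

  ℕ⇒ℚ-+ : ∀ m n → ℕ⇒ℚ (m ℕ.+ n) ≡ ℕ⇒ℚ m + ℕ⇒ℚ n
  ℕ⇒ℚ-+ m n = toℚᵘ-injective (ℚᵘₚ.≃-trans (toℚᵘ-/ (+ (m ℕ.+ n)) 1)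
    (ℚᵘₚ.≃-trans (ℚᵘ.*≡* (cong (ℤ._* + 1) lemma))
    (ℚᵘₚ.≃-sym (ℚᵘₚ.≃-trans (toℚᵘ-homo-+ (ℕ⇒ℚ m) (ℕ⇒ℚ n))
      (ℚᵘₚ.+-cong (toℚᵘ-/ (+ m) 1) (toℚᵘ-/ (+ n) 1))))))
    where
    lemma : + (m ℕ.+ n) ≡ + m ℤ.* + 1 ℤ.+ + n ℤ.* + 1
    lemma = sym (cong₂ ℤ._+_ (ℤₚ.*-identityʳ (+ m)) (ℤₚ.*-identityʳ (+ n)))

  /-* : ∀ i m j n .{{_ : ℕ.NonZero m}} .{{_ : ℕ.NonZero n}} .{{_ : ℕ.NonZero (m ℕ.* n)}} →
        (i / m) * (j / n) ≡ (i ℤ.* j) / (m ℕ.* n)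
  /-* i m@(suc _) j n@(suc _) = toℚᵘ-injective
    (ℚᵘₚ.≃-trans (toℚᵘ-homo-* (i / m) (j / n))
    (ℚᵘₚ.≃-trans (ℚᵘₚ.*-cong (toℚᵘ-/ i m) (toℚᵘ-/ j n))
    (ℚᵘₚ.≃-sym (toℚᵘ-/ (i ℤ.* j) (m ℕ.* n)))))

  n/n≡1 : ∀ n .{{_ : ℕ.NonZero n}} → + n / n ≡ 1ℚ
  n/n≡1 n@(suc _) = toℚᵘ-injective
    (ℚᵘₚ.≃-trans (toℚᵘ-/ (+ n) n) (ℚᵘ.*≡* (ℤₚ.*-comm (+ n) (+ 1))))

  1/-inverse : ∀ n .{{_ : ℕ.NonZero n}} → ℕ⇒ℚ n * (+ 1 / n) ≡ 1ℚ
  1/-inverse n@(suc _) = trans (/-* (+ n) 1 (+ 1) n)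
    (trans (/-cong (ℤₚ.*-identityʳ (+ n)) (ℕₚ.*-identityˡ n)) (n/n≡1 n))

  1/-pos : ∀ n .{{_ : ℕ.NonZero n}} → Positive (+ 1 / n)
  1/-pos n = normalize-pos 1 n

  0≤½ : NonNegative ½
  0≤½ = _

  *-monoˡ : ∀ {p q} r → 0ℚ ≤ r → p ≤ q → r * p ≤ r * q
  *-monoˡ r 0≤r = *-monoˡ-≤-nonNeg r {{nonNegative 0≤r}}

  *-mono : ∀ {p q r s} → 0ℚ ≤ p → 0ℚ ≤ s → p ≤ q → r ≤ s → p * r ≤ q * s
  *-mono {p} {q} {r} {s} 0≤p 0≤s p≤q r≤s = ≤-trans (*-monoˡ p 0≤p r≤s)
    (*-monoʳ-≤-nonNeg s {{nonNegative 0≤s}} p≤q)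

  *-nonNeg : ∀ {p q} → 0ℚ ≤ p → 0ℚ ≤ q → 0ℚ ≤ p * q
  *-nonNeg {p} {q} 0≤p 0≤q = subst (_≤ p * q) (*-zeroʳ p) (*-monoˡ p 0≤p 0≤q)

  *-pos : ∀ {p q} → 0ℚ < p → 0ℚ < q → 0ℚ < p * q
  *-pos {p} {q} 0<p 0<q =
    positive⁻¹ (p * q) {{pos*pos⇒pos p {{positive 0<p}} q {{positive 0<q}}}}

  ½-pos : ∀ {ε} → 0ℚ < ε → 0ℚ < ½ * ε
  ½-pos = *-pos (positive⁻¹ ½)

  ½+½ : ∀ ε → ½ * ε + ½ * ε ≡ ε
  ½+½ ε = trans (sym (*-distribʳ-+ ε ½ ½)) (*-identityˡ ε)

  halves : ∀ {p q ε} → p < ½ * ε → q < ½ * ε → p + q < ε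
  halves {p} {q} {ε} p< q< = subst (p + q <_) (½+½ ε) (+-mono-< p< q<)

  triangle : ∀ p q r → ∣ p - r ∣ ≤ ∣ p - q ∣ + ∣ q - r ∣
  triangle p q r = subst (λ t → ∣ t ∣ ≤ ∣ p - q ∣ + ∣ q - r ∣)
    (solve 3 (λ p q r → (p :+ :- q) :+ (q :+ :- r) := p :+ :- r) refl p q r)
    (∣p+q∣≤∣p∣+∣q∣ (p - q) (q - r))
    where open +-*-Solver

  ∣-∣-comm : ∀ p q → ∣ p - q ∣ ≡ ∣ q - p ∣
  ∣-∣-comm p q = trans (sym (∣-p∣≡∣p∣ (p - q)))
    (cong ∣_∣ (solve 2 (λ p q → :- (p :+ :- q) := q :+ :- p) refl p q))
    where open +-*-Solver

  ∣p∣-∣q∣≤∣p-q∣ : ∀ p q → ∣ p ∣ ≤ ∣ q ∣ + ∣ p - q ∣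
  ∣p∣-∣q∣≤∣p-q∣ p q = subst (λ t → ∣ t ∣ ≤ ∣ q ∣ + ∣ p - q ∣)
    (solve 2 (λ p q → q :+ (p :+ :- q) := p) refl p q) (∣p+q∣≤∣p∣+∣q∣ q (p - q))
    where open +-*-Solver

  ≤⇒-≤ : ∀ {p q r} → p ≤ q + r → p - q ≤ r
  ≤⇒-≤ {p} {q} {r} h = subst (p - q ≤_)
    (solve 2 (λ q r → (q :+ r) :+ :- q := r) refl q r) (+-monoˡ-≤ (- q) h)
    where open +-*-Solver

  p≤∣p∣ : ∀ p → p ≤ ∣ p ∣
  p≤∣p∣ p with ≤-total 0ℚ p
  ... | inj₁ 0≤p = ≤-reflexive (sym (0≤p⇒∣p∣≡p 0≤p))
  ... | inj₂ p≤0 = ≤-trans p≤0 (0≤∣p∣ p)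

  ∣∣p∣-∣q∣∣≤∣p-q∣ : ∀ p q → ∣ ∣ p ∣ - ∣ q ∣ ∣ ≤ ∣ p - q ∣
  ∣∣p∣-∣q∣∣≤∣p-q∣ p q with ∣p∣≡p∨∣p∣≡-p (∣ p ∣ - ∣ q ∣)
  ... | inj₁ e = subst (_≤ ∣ p - q ∣) (sym e) (≤⇒-≤ (∣p∣-∣q∣≤∣p-q∣ p q))
  ... | inj₂ e = subst (_≤ ∣ p - q ∣)
    (trans (solve 2 (λ a b → b :+ :- a := :- (a :+ :- b)) refl ∣ p ∣ ∣ q ∣) (sym e))
    (≤⇒-≤ (subst (λ t → ∣ q ∣ ≤ ∣ p ∣ + t) (∣-∣-comm q p) (∣p∣-∣q∣≤∣p-q∣ q p)))
    where open +-*-Solver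

  ∣p∣≤ℕ : ∀ p → ∣ p ∣ ≤ ℕ⇒ℚ ℤ.∣ ↥ p ∣
  ∣p∣≤ℕ p@(mkℚ n d _) = toℚᵘ-cancel-≤ (ℚᵘₚ.≤-respʳ-≃ (ℚᵘₚ.≃-sym (toℚᵘ-/ (+ ℤ.∣ n ∣) 1))
    (ℚᵘ.*≤* (ℤₚ.*-monoˡ-≤-nonNeg (+ ℤ.∣ n ∣) (ℤ.+≤+ (ℕ.s≤s ℕ.z≤n)))))

  -- The witness is ε / (1 + n).
  shrink : ∀ n {ε} → 0ℚ < ε → Σ[ δ ∈ ℚ ] 0ℚ < δ × ℕ⇒ℚ n * δ < ε
  shrink n {ε} 0<ε = δ , 0<δ , n*δ<ε
    where
    δ = (+ 1 / suc n) * ε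
    0<δ = *-pos (positive⁻¹ (+ 1 / suc n) {{1/-pos (suc n)}}) 0<ε
    eq : δ + ℕ⇒ℚ n * δ ≡ ε
    eq = trans (solve 2 (λ a d → d :+ a :* d := (con 1ℚ :+ a) :* d) refl (ℕ⇒ℚ n) δ)
      (trans (cong (_* δ) (sym (ℕ⇒ℚ-+ 1 n)))
      (trans (sym (*-assoc (ℕ⇒ℚ (suc n)) (+ 1 / suc n) ε))
      (trans (cong (_* ε) (1/-inverse (suc n))) (*-identityˡ ε))))
      where open +-*-Solver
    n*δ<ε : ℕ⇒ℚ n * δ < ε
    n*δ<ε = subst (ℕ⇒ℚ n * δ <_) eq
      (subst (_< δ + ℕ⇒ℚ n * δ) (+-identityˡ _) (+-monoˡ-< (ℕ⇒ℚ n * δ) 0<δ))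

  term : ℚ → ℕ → ℚ
  term q k = (+ 1 / k !) {{ℕₚ._!≢0 k}} * q ^ k

  partialExp : ℚ → ℕ → ℚ
  partialExp q n = ∑[ k ≤ n ] term q k

  1/!-suc : ∀ k → (+ 1 / (suc k) !) {{ℕₚ._!≢0 (suc k)}} ≡
                  (+ 1 / suc k) * (+ 1 / k !) {{ℕₚ._!≢0 k}}
  1/!-suc k = sym (/-* (+ 1) (suc k) (+ 1) (k !)
    {{_}} {{ℕₚ._!≢0 k}} {{ℕₚ._!≢0 (suc k)}})

  term-suc : ∀ q k → term q (suc k) ≡ ((+ 1 / suc k) * q) * term q k
  term-suc q k = trans (cong (_* (q * q ^ k)) (1/!-suc k))
    (solve 4 (λ a b q r → (a :* b) :* (q :* r) := (a :* q) :* (b :* r)) refl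
      (+ 1 / suc k) ((+ 1 / k !) {{ℕₚ._!≢0 k}}) q (q ^ k))
    where open +-*-Solver

  0≤1/ : ∀ n .{{_ : ℕ.NonZero n}} → 0ℚ ≤ + 1 / n
  0≤1/ n = <⇒≤ (positive⁻¹ (+ 1 / n) {{1/-pos n}})

  module _ (B : ℕ) where

    t : ℕ → ℚ
    t = term (ℕ⇒ℚ B)

    0≤t : ∀ k → 0ℚ ≤ t k
    0≤t zero    = nonNegative⁻¹ (t 0)
    0≤t (suc k) = subst (0ℚ ≤_) (sym (term-suc (ℕ⇒ℚ B) k))
      (*-nonNeg (*-nonNeg (0≤1/ (suc k)) (0≤ℕ⇒ℚ B)) (0≤t k))

    ∣term∣≤t : ∀ {q} → ∣ q ∣ ≤ ℕ⇒ℚ B → ∀ k → ∣ term q k ∣ ≤ t k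
    ∣term∣≤t {q} q≤B zero    = ≤-refl
    ∣term∣≤t {q} q≤B (suc k) = begin
      ∣ term q (suc k) ∣                      ≡⟨ cong ∣_∣ (term-suc q k) ⟩
      ∣ ((+ 1 / suc k) * q) * term q k ∣      ≡⟨ ∣p*q∣≡∣p∣*∣q∣ ((+ 1 / suc k) * q) (term q k) ⟩
      ∣ (+ 1 / suc k) * q ∣ * ∣ term q k ∣    ≡⟨ cong (_* ∣ term q k ∣) (∣p*q∣≡∣p∣*∣q∣ (+ 1 / suc k) q) ⟩
      (∣ + 1 / suc k ∣ * ∣ q ∣) * ∣ term q k ∣
        ≡⟨ cong (λ u → (u * ∣ q ∣) * ∣ term q k ∣) (0≤p⇒∣p∣≡p (0≤1/ (suc k))) ⟩
      ((+ 1 / suc k) * ∣ q ∣) * ∣ term q k ∣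
        ≤⟨ *-mono (*-nonNeg (0≤1/ (suc k)) (0≤∣p∣ q)) (0≤t k)
             (*-monoˡ (+ 1 / suc k) (0≤1/ (suc k)) q≤B) (∣term∣≤t q≤B k) ⟩
      ((+ 1 / suc k) * ℕ⇒ℚ B) * t k           ≡⟨ sym (term-suc (ℕ⇒ℚ B) k) ⟩
      t (suc k)                               ∎
      where open ≤-Reasoning

    K : ℕ
    K = B ℕ.+ B

    2B≤suc : ∀ {k} → K ℕ.≤ k → ℕ⇒ℚ B + ℕ⇒ℚ B ≤ ℕ⇒ℚ (suc k)
    2B≤suc {k} K≤k = subst (_≤ ℕ⇒ℚ (suc k)) (ℕ⇒ℚ-+ B B) (subst (ℕ⇒ℚ K ≤_)
      (trans (sym (ℕ⇒ℚ-+ K (suc k ∸ K))) (cong ℕ⇒ℚ (ℕₚ.m+[n∸m]≡n (ℕₚ.m≤n⇒m≤1+n K≤k))))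
      (subst (_≤ ℕ⇒ℚ K + ℕ⇒ℚ (suc k ∸ K)) (+-identityʳ (ℕ⇒ℚ K))
        (+-monoʳ-≤ (ℕ⇒ℚ K) (0≤ℕ⇒ℚ (suc k ∸ K)))))

    t-halves : ∀ {k} → K ℕ.≤ k → t (suc k) + t (suc k) ≤ t k
    t-halves {k} K≤k = begin
      t (suc k) + t (suc k)  ≡⟨ cong₂ _+_ (term-suc (ℕ⇒ℚ B) k) (term-suc (ℕ⇒ℚ B) k) ⟩
      ((+ 1 / suc k) * ℕ⇒ℚ B) * t k + ((+ 1 / suc k) * ℕ⇒ℚ B) * t k
        ≡⟨ solve 3 (λ i b t → (i :* b) :* t :+ (i :* b) :* t := (i :* (b :+ b)) :* t) refl
             (+ 1 / suc k) (ℕ⇒ℚ B) (t k) ⟩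
      ((+ 1 / suc k) * (ℕ⇒ℚ B + ℕ⇒ℚ B)) * t k
        ≤⟨ *-mono (*-nonNeg (0≤1/ (suc k)) (+-mono-≤ (0≤ℕ⇒ℚ B) (0≤ℕ⇒ℚ B))) (0≤t k)
             (*-monoˡ (+ 1 / suc k) (0≤1/ (suc k)) (2B≤suc K≤k)) ≤-refl ⟩
      ((+ 1 / suc k) * ℕ⇒ℚ (suc k)) * t k
        ≡⟨ cong (_* t k) (trans (*-comm (+ 1 / suc k) (ℕ⇒ℚ (suc k))) (1/-inverse (suc k))) ⟩
      1ℚ * t k               ≡⟨ *-identityˡ (t k) ⟩
      t k                    ∎
      where
      open ≤-Reasoning
      open +-*-Solver

    tail : ∀ {q n} → ∣ q ∣ ≤ ℕ⇒ℚ B → K ℕ.≤ n → ∀ d →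
           ∣ partialExp q (d ℕ.+ n) - partialExp q n ∣ + t (d ℕ.+ n) ≤ t n
    tail {q} {n} q≤B K≤n zero = ≤-reflexive
      (trans (cong (λ u → ∣ u ∣ + t n) (+-inverseʳ (partialExp q n))) (+-identityˡ (t n)))
    tail {q} {n} q≤B K≤n (suc d) = begin
      ∣ (e₁ + u) - e₀ ∣ + t′
        ≡⟨ cong (λ v → ∣ v ∣ + t′)
             (solve 3 (λ e u f → (e :+ u) :+ :- f := (e :+ :- f) :+ u) refl e₁ u e₀) ⟩
      ∣ (e₁ - e₀) + u ∣ + t′      ≤⟨ +-monoˡ-≤ t′ (∣p+q∣≤∣p∣+∣q∣ (e₁ - e₀) u) ⟩
      (∣ e₁ - e₀ ∣ + ∣ u ∣) + t′
        ≤⟨ +-monoˡ-≤ t′ (+-monoʳ-≤ ∣ e₁ - e₀ ∣ (∣term∣≤t q≤B (suc d ℕ.+ n))) ⟩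
      (∣ e₁ - e₀ ∣ + t′) + t′     ≡⟨ +-assoc ∣ e₁ - e₀ ∣ t′ t′ ⟩
      ∣ e₁ - e₀ ∣ + (t′ + t′)
        ≤⟨ +-monoʳ-≤ ∣ e₁ - e₀ ∣ (t-halves (ℕₚ.≤-trans K≤n (ℕₚ.m≤n+m n d))) ⟩
      ∣ e₁ - e₀ ∣ + t (d ℕ.+ n)   ≤⟨ tail q≤B K≤n d ⟩
      t n                         ∎
      where
      open ≤-Reasoning
      open +-*-Solver
      e₀ = partialExp q n
      e₁ = partialExp q (d ℕ.+ n)
      u  = term q (suc d ℕ.+ n)
      t′ = t (suc d ℕ.+ n)

    tail-bound : ∀ {q n m} → ∣ q ∣ ≤ ℕ⇒ℚ B → K ℕ.≤ n → n ℕ.≤ m →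
                 ∣ partialExp q m - partialExp q n ∣ ≤ t n
    tail-bound {q} {n} {m} q≤B K≤n n≤m =
      subst (λ i → ∣ partialExp q i - partialExp q n ∣ ≤ t n) (ℕₚ.m∸n+n≡m n≤m)
        (≤-trans (subst (_≤ ∣ e ∣ + t (m ∸ n ℕ.+ n)) (+-identityʳ ∣ e ∣)
                   (+-monoʳ-≤ ∣ e ∣ (0≤t (m ∸ n ℕ.+ n))))
                 (tail q≤B K≤n (m ∸ n)))
      where e = partialExp q (m ∸ n ℕ.+ n) - partialExp q n

    t-decay : ∀ d → ℕ⇒ℚ (suc d) * t (d ℕ.+ K) ≤ t K
    t-decay zero    = ≤-reflexive (*-identityˡ (t K))
    t-decay (suc d) = begin
      ℕ⇒ℚ (suc (suc d)) * t′        ≡⟨ cong (_* t′) (ℕ⇒ℚ-+ 1 (suc d)) ⟩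
      (1ℚ + s) * t′                 ≡⟨ *-distribʳ-+ t′ 1ℚ s ⟩
      1ℚ * t′ + s * t′              ≤⟨ +-monoˡ-≤ (s * t′) (*-mono (0≤ℕ⇒ℚ 1) (0≤t (suc d ℕ.+ K)) 1≤s ≤-refl) ⟩
      s * t′ + s * t′               ≡⟨ sym (*-distribˡ-+ s t′ t′) ⟩
      s * (t′ + t′)                 ≤⟨ *-monoˡ s (0≤ℕ⇒ℚ (suc d)) (t-halves (ℕₚ.m≤n+m K d)) ⟩
      s * t (d ℕ.+ K)               ≤⟨ t-decay d ⟩
      t K                           ∎
      where
      open ≤-Reasoning
      s  = ℕ⇒ℚ (suc d)
      t′ = t (suc d ℕ.+ K)
      1≤s : 1ℚ ≤ s
      1≤s = subst (1ℚ ≤_) (sym (ℕ⇒ℚ-+ 1 d))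
        (subst (_≤ 1ℚ + ℕ⇒ℚ d) (+-identityʳ 1ℚ) (+-monoʳ-≤ 1ℚ (0≤ℕ⇒ℚ d)))

    t-small : ∀ {ε} → 0ℚ < ε → Σ[ n ∈ ℕ ] K ℕ.≤ n × t n < ε
    t-small {ε} 0<ε = d ℕ.+ K , ℕₚ.m≤n+m K d , tn<ε
      where
      T = ℤ.∣ ↥ (t K) ∣
      δ<  = shrink T 0<ε
      δ   = proj₁ δ<
      0<δ = proj₁ (proj₂ δ<)
      D = ℤ.∣ ↥ ((1/ δ) {{>-nonZero 0<δ}}) ∣
      d = D
      instance _ = >-nonZero 0<δ
      1≤Dδ : 1ℚ ≤ ℕ⇒ℚ D * δ
      1≤Dδ = subst (_≤ ℕ⇒ℚ D * δ) (*-inverseˡ δ)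
        (*-monoʳ-≤-nonNeg δ {{nonNegative (<⇒≤ 0<δ)}} (≤-trans (p≤∣p∣ (1/ δ)) (∣p∣≤ℕ (1/ δ))))
      tK<Dε : t K < ℕ⇒ℚ (suc D) * ε
      tK<Dε = begin-strict
        t K                        ≤⟨ ≤-trans (p≤∣p∣ (t K)) (∣p∣≤ℕ (t K)) ⟩
        ℕ⇒ℚ T                      ≡⟨ sym (*-identityʳ (ℕ⇒ℚ T)) ⟩
        ℕ⇒ℚ T * 1ℚ                 ≤⟨ *-monoˡ (ℕ⇒ℚ T) (0≤ℕ⇒ℚ T) 1≤Dδ ⟩
        ℕ⇒ℚ T * (ℕ⇒ℚ D * δ)        ≡⟨ solve 3 (λ a b c → a :* (b :* c) := b :* (a :* c)) refl (ℕ⇒ℚ T) (ℕ⇒ℚ D) δ ⟩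
        ℕ⇒ℚ D * (ℕ⇒ℚ T * δ)        ≤⟨ *-monoˡ (ℕ⇒ℚ D) (0≤ℕ⇒ℚ D) (<⇒≤ (proj₂ (proj₂ δ<))) ⟩
        ℕ⇒ℚ D * ε                  ≡⟨ sym (+-identityˡ (ℕ⇒ℚ D * ε)) ⟩
        0ℚ + ℕ⇒ℚ D * ε             <⟨ +-monoˡ-< (ℕ⇒ℚ D * ε) 0<ε ⟩
        ε + ℕ⇒ℚ D * ε              ≡⟨ solve 2 (λ e a → e :+ a :* e := (con 1ℚ :+ a) :* e) refl ε (ℕ⇒ℚ D) ⟩
        (1ℚ + ℕ⇒ℚ D) * ε           ≡⟨ cong (_* ε) (sym (ℕ⇒ℚ-+ 1 D)) ⟩
        ℕ⇒ℚ (suc D) * ε            ∎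
        where
        open ≤-Reasoning
        open +-*-Solver
      tn<ε : t (d ℕ.+ K) < ε
      tn<ε = *-cancelˡ-<-nonNeg (ℕ⇒ℚ (suc D)) {{ℕ⇒ℚ-nonNeg (suc D)}}
        (≤-<-trans (t-decay d) tK<Dε)

open Rational using (ℕ⇒ℚ; halves; ½-pos; triangle; shrink; partialExp)

IsCauchy : (ℕ → ℚ) → Set
IsCauchy s = ∀ ε → 0ℚ ℚ.< ε →
  ∃[ N ] (∀ m n → N ℕ.≤ m → N ℕ.≤ n → ℚ.∣ s m ℚ.- s n ∣ ℚ.< ε)

record ℝ : Set where
  constructor mkℝ
  field
    seq    : ℕ → ℚ
    cauchy : IsCauchy seq

open ℝ public

infix 4 _≃_ _≤_ _<_

-- This is the equality of real numbers; the quotient itself is not formed.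
_≃_ : ℝ → ℝ → Set
x ≃ y = ∀ ε → 0ℚ ℚ.< ε → ∃[ N ] (∀ n → N ℕ.≤ n → ℚ.∣ seq x n ℚ.- seq y n ∣ ℚ.< ε)

_<_ : ℝ → ℝ → Set
x < y = ∃[ ε ] (0ℚ ℚ.< ε × (∃[ N ] (∀ n → N ℕ.≤ n → seq x n ℚ.+ ε ℚ.< seq y n)))

_≤_ : ℝ → ℝ → Set
x ≤ y = ∀ ε → 0ℚ ℚ.< ε → ∃[ N ] (∀ n → N ℕ.≤ n → seq x n ℚ.< seq y n ℚ.+ ε)

fromℚ : ℚ → ℝ
fromℚ q = mkℝ (λ _ → q) λ ε 0<ε → 0 , λ _ _ _ _ →
  subst (λ u → ℚ.∣ u ∣ ℚ.< ε) (sym (ℚₚ.+-inverseʳ q)) 0<ε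

ℕ⇒ℝ : ℕ → ℝ
ℕ⇒ℝ n = fromℚ (ℕ⇒ℚ n)

0ℝ 1ℝ : ℝ
0ℝ = fromℚ 0ℚ
1ℝ = fromℚ 1ℚ

bounded : ∀ x → ∃[ B ] ∃[ N ] (∀ n → N ℕ.≤ n → ℚ.∣ seq x n ∣ ℚ.≤ ℕ⇒ℚ B)
bounded x with cauchy x 1ℚ (ℚₚ.positive⁻¹ 1ℚ)
... | N , c = suc b , N , λ n N≤n → begin
  ℚ.∣ seq x n ∣                                ≤⟨ Rational.∣p∣-∣q∣≤∣p-q∣ (seq x n) (seq x N) ⟩
  ℚ.∣ seq x N ∣ ℚ.+ ℚ.∣ seq x n ℚ.- seq x N ∣
    ≤⟨ ℚₚ.+-mono-≤ (Rational.∣p∣≤ℕ (seq x N)) (ℚₚ.<⇒≤ (c n N N≤n ℕₚ.≤-refl)) ⟩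
  ℕ⇒ℚ b ℚ.+ 1ℚ                                 ≡⟨ ℚₚ.+-comm (ℕ⇒ℚ b) 1ℚ ⟩
  1ℚ ℚ.+ ℕ⇒ℚ b                                 ≡⟨ sym (Rational.ℕ⇒ℚ-+ 1 b) ⟩
  ℕ⇒ℚ (suc b)                                  ∎
  where
  open ℚₚ.≤-Reasoning
  b = ℤ.∣ ℚ.↥ seq x N ∣

infixl 6 _+_ _-_
infixl 7 _*_ _÷_
infix  8 -_

_+_ : ℝ → ℝ → ℝ
x + y = mkℝ (λ n → seq x n ℚ.+ seq y n) λ ε 0<ε →
  let N₁ , c₁ = cauchy x (½ ℚ.* ε) (½-pos 0<ε)
      N₂ , c₂ = cauchy y (½ ℚ.* ε) (½-pos 0<ε)
  in N₁ ℕ.⊔ N₂ , λ m n N≤m N≤n →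
    ℚₚ.≤-<-trans (bound (seq x m) (seq y m) (seq x n) (seq y n))
      (halves (c₁ m n (ℕₚ.m⊔n≤o⇒m≤o N₁ N₂ N≤m) (ℕₚ.m⊔n≤o⇒m≤o N₁ N₂ N≤n))
              (c₂ m n (ℕₚ.m⊔n≤o⇒n≤o N₁ N₂ N≤m) (ℕₚ.m⊔n≤o⇒n≤o N₁ N₂ N≤n)))
  where
  bound : ∀ a b c d → ℚ.∣ (a ℚ.+ b) ℚ.- (c ℚ.+ d) ∣ ℚ.≤ ℚ.∣ a ℚ.- c ∣ ℚ.+ ℚ.∣ b ℚ.- d ∣
  bound a b c d = subst (λ u → ℚ.∣ u ∣ ℚ.≤ ℚ.∣ a ℚ.- c ∣ ℚ.+ ℚ.∣ b ℚ.- d ∣)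
    (solve 4 (λ a b c d → (a :+ :- c) :+ (b :+ :- d) := (a :+ b) :+ :- (c :+ d)) refl a b c d)
    (ℚₚ.∣p+q∣≤∣p∣+∣q∣ (a ℚ.- c) (b ℚ.- d))
    where open +-*-Solver

-_ : ℝ → ℝ
- x = mkℝ (λ n → ℚ.- seq x n) λ ε 0<ε →
  let N , c = cauchy x ε 0<ε
  in N , λ m n N≤m N≤n → subst (ℚ._< ε) (flip (seq x m) (seq x n)) (c m n N≤m N≤n)
  where
  flip : ∀ p q → ℚ.∣ p ℚ.- q ∣ ≡ ℚ.∣ ℚ.- p ℚ.- ℚ.- q ∣
  flip p q = trans (sym (ℚₚ.∣-p∣≡∣p∣ (p ℚ.- q)))
    (cong ℚ.∣_∣ (solve 2 (λ p q → :- (p :+ :- q) := :- p :+ :- (:- q)) refl p q))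
    where open +-*-Solver

_-_ : ℝ → ℝ → ℝ
x - y = x + (- y)

∣_∣ : ℝ → ℝ
∣ x ∣ = mkℝ (λ n → ℚ.∣ seq x n ∣) λ ε 0<ε →
  let N , c = cauchy x ε 0<ε
  in N , λ m n N≤m N≤n →
    ℚₚ.≤-<-trans (Rational.∣∣p∣-∣q∣∣≤∣p-q∣ (seq x m) (seq x n)) (c m n N≤m N≤n)

_*_ : ℝ → ℝ → ℝ
x * y = mkℝ (λ n → seq x n ℚ.* seq y n) λ ε 0<ε →
  let B₁ , M₁ , b₁ = bounded x
      B₂ , M₂ , b₂ = bounded y
      δ₁ , 0<δ₁ , s₁ = shrink B₁ (½-pos 0<ε)
      δ₂ , 0<δ₂ , s₂ = shrink B₂ (½-pos 0<ε)
      N₁ , c₁ = cauchy y δ₁ 0<δ₁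
      N₂ , c₂ = cauchy x δ₂ 0<δ₂
  in (M₁ ℕ.⊔ M₂) ℕ.⊔ (N₁ ℕ.⊔ N₂) , λ m n ≤m ≤n →
    let M≤m = ℕₚ.m⊔n≤o⇒m≤o (M₁ ℕ.⊔ M₂) (N₁ ℕ.⊔ N₂) ≤m
        M≤n = ℕₚ.m⊔n≤o⇒m≤o (M₁ ℕ.⊔ M₂) (N₁ ℕ.⊔ N₂) ≤n
        N≤m = ℕₚ.m⊔n≤o⇒n≤o (M₁ ℕ.⊔ M₂) (N₁ ℕ.⊔ N₂) ≤m
        N≤n = ℕₚ.m⊔n≤o⇒n≤o (M₁ ℕ.⊔ M₂) (N₁ ℕ.⊔ N₂) ≤n
    in ℚₚ.≤-<-trans (bound (seq x m) (seq y m) (seq x n) (seq y n))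
      (halves
        (ℚₚ.≤-<-trans
          (Rational.*-mono (ℚₚ.0≤∣p∣ (seq x m)) (ℚₚ.<⇒≤ 0<δ₁)
            (b₁ m (ℕₚ.m⊔n≤o⇒m≤o M₁ M₂ M≤m))
            (ℚₚ.<⇒≤ (c₁ m n (ℕₚ.m⊔n≤o⇒m≤o N₁ N₂ N≤m) (ℕₚ.m⊔n≤o⇒m≤o N₁ N₂ N≤n)))) s₁)
        (ℚₚ.≤-<-trans
          (Rational.*-mono (ℚₚ.0≤∣p∣ (seq y n)) (ℚₚ.<⇒≤ 0<δ₂)
            (b₂ n (ℕₚ.m⊔n≤o⇒n≤o M₁ M₂ M≤n))
            (ℚₚ.<⇒≤ (c₂ m n (ℕₚ.m⊔n≤o⇒n≤o N₁ N₂ N≤m) (ℕₚ.m⊔n≤o⇒n≤o N₁ N₂ N≤n)))) s₂))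
  where
  bound : ∀ a b c d → ℚ.∣ a ℚ.* b ℚ.- c ℚ.* d ∣ ℚ.≤
                      ℚ.∣ a ∣ ℚ.* ℚ.∣ b ℚ.- d ∣ ℚ.+ ℚ.∣ d ∣ ℚ.* ℚ.∣ a ℚ.- c ∣
  bound a b c d = begin
    ℚ.∣ a ℚ.* b ℚ.- c ℚ.* d ∣
      ≡⟨ cong ℚ.∣_∣ (solve 4 (λ a b c d → a :* b :+ :- (c :* d) :=
           a :* (b :+ :- d) :+ d :* (a :+ :- c)) refl a b c d) ⟩
    ℚ.∣ a ℚ.* (b ℚ.- d) ℚ.+ d ℚ.* (a ℚ.- c) ∣
      ≤⟨ ℚₚ.∣p+q∣≤∣p∣+∣q∣ (a ℚ.* (b ℚ.- d)) (d ℚ.* (a ℚ.- c)) ⟩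
    ℚ.∣ a ℚ.* (b ℚ.- d) ∣ ℚ.+ ℚ.∣ d ℚ.* (a ℚ.- c) ∣
      ≡⟨ cong₂ ℚ._+_ (ℚₚ.∣p*q∣≡∣p∣*∣q∣ a (b ℚ.- d)) (ℚₚ.∣p*q∣≡∣p∣*∣q∣ d (a ℚ.- c)) ⟩
    ℚ.∣ a ∣ ℚ.* ℚ.∣ b ℚ.- d ∣ ℚ.+ ℚ.∣ d ∣ ℚ.* ℚ.∣ a ℚ.- c ∣ ∎
    where
    open ℚₚ.≤-Reasoning
    open +-*-Solver

_÷_ : ℝ → (n : ℕ) .{{_ : NonZero n}} → ℝ
x ÷ n = fromℚ (+ 1 ℚ./ n) * x

ℝ-rawRing : RawRing 0ℓ 0ℓ
ℝ-rawRing = record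
  { Carrier = ℝ
  ; _≈_     = _≃_
  ; _+_     = _+_
  ; _*_     = _*_
  ; -_      = -_
  ; 0#      = 0ℝ
  ; 1#      = 1ℝ
  }

open RawRing ℝ-rawRing public using () renaming (rawSemiring to ℝ-rawSemiring)
open SemiringDefs ℝ-rawSemiring public using (_^_; sum)
open FiniteSums ℝ-rawSemiring public

infix 4 _⟶_

_⟶_ : (ℕ → ℝ) → ℝ → Set
s ⟶ l = ∀ ε → 0ℝ < ε → ∃[ N ] (∀ n → N ℕ.≤ n → ∣ s n - l ∣ < ε)

HasSum : (ℕ → ℝ) → ℝ → Set
HasSum f s = (λ n → ∑[ k ≤ n ] f k) ⟶ s

expTerm : ℝ → ℕ → ℝ
expTerm x k = (x ^ k ÷ k !) {{ℕₚ._!≢0 k}}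

seq-expTerm : ∀ x k i → seq (expTerm x k) i ≡ Rational.term (seq x i) k
seq-expTerm x k i = cong ((+ 1 ℚ./ k !) {{ℕₚ._!≢0 k}} ℚ.*_) (seq-^ k)
  where
  open SemiringDefs ℚ.+-*-rawSemiring renaming (_^_ to _^ℚ_)
  seq-^ : ∀ k → seq (x ^ k) i ≡ seq x i ^ℚ k
  seq-^ zero    = refl
  seq-^ (suc k) = cong (seq x i ℚ.*_) (seq-^ k)

seq-partialExp : ∀ x n i → seq (∑[ k ≤ n ] expTerm x k) i ≡ partialExp (seq x i) n
seq-partialExp x zero    i = seq-expTerm x 0 i
seq-partialExp x (suc n) i = cong₂ ℚ._+_ (seq-partialExp x n i) (seq-expTerm x (suc n) i)

-- The n-th approximant of exp x is the n-th partial sum of the exponential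
-- series at the n-th approximant of x; exp-hasSum below shows that exp x is
-- the sum of the series.
exp : ℝ → ℝ
exp x = mkℝ (λ n → partialExp (seq x n) n) λ ε 0<ε →
  let B , M , b = bounded x
      ε′ = ½ ℚ.* ε
      n₀ , K≤n₀ , tn₀< = Rational.t-small B (½-pos (½-pos 0<ε))
      N , c = cauchy (∑[ k ≤ n₀ ] expTerm x k) ε′ (½-pos 0<ε)
  in (M ℕ.⊔ n₀) ℕ.⊔ N , λ m n ≤m ≤n →
    let M≤m  = ℕₚ.m⊔n≤o⇒m≤o (M ℕ.⊔ n₀) N ≤m
        M≤n  = ℕₚ.m⊔n≤o⇒m≤o (M ℕ.⊔ n₀) N ≤n
        d    = Rational.tail-bound B (b m (ℕₚ.m⊔n≤o⇒m≤o M n₀ M≤m)) K≤n₀ (ℕₚ.m⊔n≤o⇒n≤o M n₀ M≤m)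
        e    = Rational.tail-bound B (b n (ℕₚ.m⊔n≤o⇒m≤o M n₀ M≤n)) K≤n₀ (ℕₚ.m⊔n≤o⇒n≤o M n₀ M≤n)
        P    = λ i → partialExp (seq x i) n₀
        mid  = subst (ℚ._< ε′)
                 (cong₂ (λ u v → ℚ.∣ u ℚ.- v ∣) (seq-partialExp x n₀ m) (seq-partialExp x n₀ n))
                 (c m n (ℕₚ.m⊔n≤o⇒n≤o (M ℕ.⊔ n₀) N ≤m) (ℕₚ.m⊔n≤o⇒n≤o (M ℕ.⊔ n₀) N ≤n))
    in chain (partialExp (seq x m) m) (P m) (P n) (partialExp (seq x n) n)
         (ℚₚ.≤-<-trans d tn₀<) mid (ℚₚ.≤-<-trans e tn₀<)
  where
  chain : ∀ a p q b {ε} → ℚ.∣ a ℚ.- p ∣ ℚ.< ½ ℚ.* (½ ℚ.* ε) → ℚ.∣ p ℚ.- q ∣ ℚ.< ½ ℚ.* ε →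
          ℚ.∣ b ℚ.- q ∣ ℚ.< ½ ℚ.* (½ ℚ.* ε) → ℚ.∣ a ℚ.- b ∣ ℚ.< ε
  chain a p q b {ε} a~p p~q b~q = begin-strict
    ℚ.∣ a ℚ.- b ∣                                       ≤⟨ triangle a p b ⟩
    ℚ.∣ a ℚ.- p ∣ ℚ.+ ℚ.∣ p ℚ.- b ∣                     ≤⟨ ℚₚ.+-monoʳ-≤ ℚ.∣ a ℚ.- p ∣ (triangle p q b) ⟩
    ℚ.∣ a ℚ.- p ∣ ℚ.+ (ℚ.∣ p ℚ.- q ∣ ℚ.+ ℚ.∣ q ℚ.- b ∣)
      ≡⟨ solve 3 (λ u v w → u :+ (v :+ w) := v :+ (u :+ w)) refl
           ℚ.∣ a ℚ.- p ∣ ℚ.∣ p ℚ.- q ∣ ℚ.∣ q ℚ.- b ∣ ⟩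
    ℚ.∣ p ℚ.- q ∣ ℚ.+ (ℚ.∣ a ℚ.- p ∣ ℚ.+ ℚ.∣ q ℚ.- b ∣)
      <⟨ halves p~q (halves a~p (subst (ℚ._< ½ ℚ.* (½ ℚ.* ε)) (Rational.∣-∣-comm b q) b~q)) ⟩
    ε                                                   ∎
    where
    open ℚₚ.≤-Reasoning
    open +-*-Solver

exp-hasSum : ∀ x → HasSum (expTerm x) (exp x)
exp-hasSum x ε (δ , 0<δ , M₁ , δ<ε) =
  let B , M , b = bounded x
      n₀ , K≤n₀ , tn₀< = Rational.t-small B (½-pos (½-pos 0<δ))
  in n₀ , λ n n₀≤n → ½ ℚ.* δ , ½-pos 0<δ , (M ℕ.⊔ M₁) ℕ.⊔ n₀ , λ i ≤i →
    let M≤i = ℕₚ.m⊔n≤o⇒m≤o (M ℕ.⊔ M₁) n₀ ≤i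
        q≤B = b i (ℕₚ.m⊔n≤o⇒m≤o M M₁ M≤i)
        p   = partialExp (seq x i) n₀
        l   = partialExp (seq x i) n
        r   = partialExp (seq x i) i
        l~p = ℚₚ.≤-<-trans (Rational.tail-bound B q≤B K≤n₀ n₀≤n) tn₀<
        r~p = ℚₚ.≤-<-trans (Rational.tail-bound B q≤B K≤n₀ (ℕₚ.m⊔n≤o⇒n≤o (M ℕ.⊔ M₁) n₀ ≤i)) tn₀<
        l~r = ℚₚ.≤-<-trans (triangle l p r)
                (halves l~p (subst (ℚ._< ½ ℚ.* (½ ℚ.* δ)) (Rational.∣-∣-comm r p) r~p))
        l~r′ = subst (λ u → ℚ.∣ u ℚ.- r ∣ ℚ.< ½ ℚ.* δ) (sym (seq-partialExp x n i)) l~r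
        δ<ε′ = subst (ℚ._< seq ε i) (ℚₚ.+-identityˡ δ) (δ<ε i (ℕₚ.m⊔n≤o⇒n≤o M M₁ M≤i))
    in ℚₚ.<-trans
         (subst (ℚ.∣ seq (∑[ k ≤ n ] expTerm x k) i ℚ.- r ∣ ℚ.+ ½ ℚ.* δ ℚ.<_) (Rational.½+½ δ) (ℚₚ.+-monoˡ-< (½ ℚ.* δ) l~r′)) δ<ε′

record TaggedPartition (a b : ℝ) : Set where
  field
    size   : ℕ
    point  : Fin (suc size) → ℝ
    tag    : Fin size → ℝ
    first  : point Fin.zero ≃ a
    last   : point (fromℕ size) ≃ b
    tagged : ∀ i → point (inject₁ i) ≤ tag i × tag i ≤ point (Fin.suc i)

  width : Fin size → ℝ
  width i = point (Fin.suc i) - point (inject₁ i)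

  riemannSum : (ℝ → ℝ) → ℝ
  riemannSum f = sum (λ i → f (tag i) * width i)

open TaggedPartition using (width; riemannSum)

HasIntegral : (ℝ → ℝ) → ℝ → ℝ → ℝ → Set
HasIntegral f a b v = ∀ ε → 0ℝ < ε → ∃[ δ ] (0ℝ < δ ×
  ((P : TaggedPartition a b) → (∀ i → width P i < δ) → ∣ riemannSum P f - v ∣ < ε))

-- F b is the integral over [a , b], required only for a ≤ b; it tends to v
-- as b → ∞.
HasImproperIntegral : (ℝ → ℝ) → ℝ → ℝ → Set
HasImproperIntegral f a v = Σ[ F ∈ (ℝ → ℝ) ]
  (∀ b → a ≤ b → HasIntegral f a b (F b)) ×
  (∀ ε → 0ℝ < ε → ∃[ B ] (∀ b → a ≤ b → B ≤ b → ∣ F b - v ∣ < ε))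

-- The library's power has x ^ 0 = 1ℝ definitionally, hence 0 ^ 0 = 1.
W̃ : (m : ℕ) .{{_ : NonZero m}} → ℝ → ℕ → ℕ → ℝ
W̃ m a n k = (∑[ j ≤ k ]
    (ℕ⇒ℝ (k C j) * (- 1ℝ) ^ (k ∸ j) * (ℕ⇒ℝ (m ℕ.* j) - a) ^ n)) ÷ (m ℕ.^ k ℕ.* k !)
  where
  instance
    _ = ℕₚ.m^n≢0 m k
    _ = ℕₚ._!≢0 k
    _ = ℕₚ.m*n≢0 (m ℕ.^ k) (k !)

F̃ : (m : ℕ) .{{_ : NonZero m}} → ℝ → ℕ → ℝ → ℝ
F̃ m a n x = ∑[ k ≤ n ] (ℕ⇒ℝ (k !) * W̃ m a n k * x ^ k)

{-# OPTIONS --safe #-}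
module Submission where

-- Write q = mz, b = -az and y = x/m. The differences Δᵏ of wⁿ/n! at w = b, b + q, … satisfy
-- a convolution recurrence in k, which turns into
--   uₙ₊₁ = bⁿ⁺¹/(n+1)! + ∑ⱼ y qʲ⁺¹/(j+1)! uₙ₋ⱼ   for uₙ = F̃ₙ zⁿ/n!.
-- For small z this recurrence is a contraction, and the partial sums of ∑ uₙ converge geometrically to
-- the fixed point exp b / c, where c = 1 - y (exp q - 1) ≥ ½. The estimate is made in ℚ, uniformly on the
-- approximants of the real numbers involved. The same value is the integral of exp (b - l c) over l ≥ 0:
-- since 1 + t ≤ exp t and exp t ≤ 1 + t exp t for t ≥ 0, the error of a Riemann sum on each
-- strip is at most the mesh times the drop of the integrand, and these drops telescope.

import Algebra.Definitions.RawSemiring as SemiringDefs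
open import Algebra.Bundles using (CommutativeRing)
import Algebra.Properties.CommutativeSemiring.Exp as Exp
open import Data.Fin.Base using (Fin; inject₁; fromℕ)
open import Data.Integer.Base as ℤ using (+_)
import Data.Integer.Properties as ℤₚ
open import Data.Nat.Base using (ℕ; NonZero; _!)
open import Data.Nat.Base as ℕ using (zero; suc; _∸_; z≤n; s≤s)
open import Data.Nat.Combinatorics using (_C_; nCk+nC[k+1]≡[n+1]C[k+1]; k>n⇒nCk≡0)
open import Data.Nat.Properties using (_!≢0)
import Data.Nat.Properties as ℕₚ
open import Data.Product.Base using (∃-syntax; _×_; _,_; proj₁; proj₂)
open import Data.Rational.Base as ℚ using (ℚ; 0ℚ; 1ℚ; ½) hiding (module ℚ)
import Data.Rational.Properties as ℚₚ
open import Data.Rational.Solver using (module +-*-Solver)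
open import Data.Sum.Base using (inj₁; inj₂)
open import Defs using (module FiniteSums; module Rational)
open import Function.Base using (_∘_)
open import Level using (0ℓ)
open import Relation.Binary.Bundles using (Poset)
import Relation.Binary.Reasoning.PartialOrder as PartialOrderReasoning
open import Relation.Binary.PropositionalEquality
  using (_≡_; refl; sym; trans; cong; cong₂; subst; module ≡-Reasoning)
open import Relation.Nullary.Decidable using (toWitness)

-- `exp` is diagonal: its approximant at index i is the exponential series cut at degree i. Such
-- truncations satisfy exp (p + q) = exp p exp q only approximately, but the recurrence for the
-- partial sums of ∑ uₙ is exact in ℚ. With exp b and P = y (exp q - 1) both cut at the degree given
-- by the index, the limiting equation s = exp b + s P has the exact rational solution exp b / (1 -
-- P), which is the approximant of the limit at that index. The partial sum up to n differs from it
-- by at most 6 / 2ⁿ, whatever the index, so no infinite sums have to be exchanged. The thresholds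
-- |b| ≤ ½, |q| ≤ ¼ and |yq| ≤ ⅛ come from measuring errors against 2⁻ⁿ: the kernel is at most ⅛
-- 4⁻ʲ, and ∑ ⅛ 4⁻ʲ 2ʲ⁺¹ = ½ is the contraction factor, one factor 2 being the price of the shift
-- from n to n + 1.

module Series where

  open ℚ hiding (NonZero)
  open ℚₚ
  open Rational
  open SemiringDefs ℚ.+-*-rawSemiring using (_^_)
  open FiniteSums ℚ.+-*-rawSemiring
  open Exp (CommutativeRing.commutativeSemiring +-*-commutativeRing) using (^-homo-*; ^-distrib-*)

  ¼ : ℚ
  ¼ = ½ * ½

  -- Finite sums and convolutions over ℚ

  ∑-cong : ∀ n {f g : ℕ → ℚ} → (∀ k → k ℕ.≤ n → f k ≡ g k) → ∑≤ n f ≡ ∑≤ n g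
  ∑-cong zero    f≡g = f≡g 0 z≤n
  ∑-cong (suc n) f≡g =
    cong₂ _+_ (∑-cong n λ k k≤n → f≡g k (ℕₚ.m≤n⇒m≤1+n k≤n)) (f≡g (suc n) ℕₚ.≤-refl)

  ∑-head : ∀ n (f : ℕ → ℚ) → ∑≤ (suc n) f ≡ f 0 + (∑[ k ≤ n ] f (suc k))
  ∑-head zero    f = refl
  ∑-head (suc n) f = trans (cong (_+ f (2 ℕ.+ n)) (∑-head n f)) (+-assoc (f 0) _ _)

  ∑-+ : ∀ n (f g : ℕ → ℚ) → ∑[ k ≤ n ] (f k + g k) ≡ ∑≤ n f + ∑≤ n g
  ∑-+ zero    f g = refl
  ∑-+ (suc n) f g = trans (cong (_+ (f (suc n) + g (suc n))) (∑-+ n f g))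
    (solve 4 (λ a b c d → (a :+ b) :+ (c :+ d) := (a :+ c) :+ (b :+ d)) refl
      (∑≤ n f) (∑≤ n g) (f (suc n)) (g (suc n)))
    where open +-*-Solver

  ∑-* : ∀ c n (f : ℕ → ℚ) → c * ∑≤ n f ≡ ∑[ k ≤ n ] (c * f k)
  ∑-* c zero    f = refl
  ∑-* c (suc n) f = trans (*-distribˡ-+ c (∑≤ n f) (f (suc n))) (cong (_+ c * f (suc n)) (∑-* c n f))

  ∑-truncate : ∀ {n} d (f : ℕ → ℚ) → (∀ k → n ℕ.< k → f k ≡ 0ℚ) → ∑≤ (d ℕ.+ n) f ≡ ∑≤ n f
  ∑-truncate     zero    f f≡0 = refl
  ∑-truncate {n} (suc d) f f≡0 =
    trans (cong₂ _+_ (∑-truncate d f f≡0) (f≡0 (suc d ℕ.+ n) (s≤s (ℕₚ.m≤n+m n d)))) (+-identityʳ _)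

  conv : (ℕ → ℚ) → (ℕ → ℚ) → ℕ → ℚ
  conv α β n = ∑[ j ≤ n ] (α j * β (n ∸ j))

  conv-cong : ∀ {α α′ β β′} n → (∀ k → α k ≡ α′ k) → (∀ k → k ℕ.≤ n → β k ≡ β′ k) →
              conv α β n ≡ conv α′ β′ n
  conv-cong n α≡ β≡ = ∑-cong n λ k _ → cong₂ _*_ (α≡ k) (β≡ (n ∸ k) (ℕₚ.m∸n≤m n k))

  conv-+ʳ : ∀ α β γ n → conv α (λ k → β k + γ k) n ≡ conv α β n + conv α γ n
  conv-+ʳ α β γ n = trans (∑-cong n λ k _ → *-distribˡ-+ (α k) _ _) (∑-+ n _ _)

  conv-*ˡ : ∀ c α β n → c * conv α β n ≡ conv (λ k → c * α k) β n
  conv-*ˡ c α β n = trans (∑-* c n _) (∑-cong n λ k _ → sym (*-assoc c (α k) _))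

  conv-*ʳ : ∀ c α β n → c * conv α β n ≡ conv α (λ k → c * β k) n
  conv-*ʳ c α β n = trans (∑-* c n _) (∑-cong n λ k _ →
    solve 3 (λ c a b → c :* (a :* b) := a :* (c :* b)) refl c (α k) (β (n ∸ k)))
    where open +-*-Solver

  conv-∑ʳ : ∀ m α (β : ℕ → ℕ → ℚ) n →
            ∑[ i ≤ m ] conv α (β i) n ≡ conv α (λ k → ∑[ i ≤ m ] β i k) n
  conv-∑ʳ zero    α β n = refl
  conv-∑ʳ (suc m) α β n = trans (cong (_+ conv α (β (suc m)) n) (conv-∑ʳ m α β n))
    (sym (conv-+ʳ α (λ k → ∑[ i ≤ m ] β i k) (β (suc m)) n))

  conv-suc : ∀ α β n → conv α β (suc n) ≡ (∑[ j ≤ n ] (α j * β (suc (n ∸ j)))) + α (suc n) * β 0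
  conv-suc α β n = cong₂ _+_
    (∑-cong n λ k k≤n → cong (λ i → α k * β i) (ℕₚ.+-∸-assoc 1 k≤n))
    (cong (λ i → α (suc n) * β i) (ℕₚ.n∸n≡0 n))

  -- Taking partial sums is multiplication of a power series by 1/(1 - t), so in a product it may be
  -- applied to one factor alone.
  ∑-conv : ∀ α β N → ∑≤ N (conv α β) ≡ conv α (λ n → ∑≤ n β) N
  ∑-conv α β zero    = refl
  ∑-conv α β (suc N) = begin
    ∑≤ N (conv α β) + conv α β (suc N)
      ≡⟨ cong₂ _+_ (∑-conv α β N) (conv-suc α β N) ⟩
    conv α (λ n → ∑≤ n β) N + ((∑[ j ≤ N ] (α j * β (suc (N ∸ j)))) + α (suc N) * β 0)
      ≡⟨ sym (+-assoc (conv α (λ n → ∑≤ n β) N) _ _) ⟩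
    (conv α (λ n → ∑≤ n β) N + (∑[ j ≤ N ] (α j * β (suc (N ∸ j))))) + α (suc N) * β 0
      ≡⟨ cong (_+ α (suc N) * β 0) (sym (∑-+ N _ _)) ⟩
    (∑[ j ≤ N ] (α j * ∑≤ (N ∸ j) β + α j * β (suc (N ∸ j)))) + α (suc N) * β 0
      ≡⟨ cong (_+ α (suc N) * β 0) (∑-cong N λ j _ → sym (*-distribˡ-+ (α j) _ _)) ⟩
    (∑[ j ≤ N ] (α j * ∑≤ (suc (N ∸ j)) β)) + α (suc N) * β 0
      ≡⟨ sym (conv-suc α (λ n → ∑≤ n β) N) ⟩
    conv α (λ n → ∑≤ n β) (suc N) ∎
    where open ≡-Reasoning

  -- Taylor coefficients of the exponential

  suc*term-suc : ∀ q k → ℕ⇒ℚ (suc k) * term q (suc k) ≡ q * term q k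
  suc*term-suc q k = trans (cong (ℕ⇒ℚ (suc k) *_) (term-suc q k))
    (trans (solve 4 (λ s i q t → s :* ((i :* q) :* t) := (s :* i) :* (q :* t)) refl
             (ℕ⇒ℚ (suc k)) (+ 1 / suc k) q (term q k))
    (trans (cong (_* (q * term q k)) (1/-inverse (suc k))) (*-identityˡ (q * term q k))))
    where open +-*-Solver

  -- The coefficients α, β of power series satisfying f′ = p f, g′ = q g.
  module _ {α β : ℕ → ℚ} {p q : ℚ}
           (α-suc : ∀ k → ℕ⇒ℚ (suc k) * α (suc k) ≡ p * α k)
           (β-suc : ∀ k → ℕ⇒ℚ (suc k) * β (suc k) ≡ q * β k) where

    -- The Leibniz rule: `suc n` is split as j + (suc n ∸ j), and each part differentiates one of
    -- the two factors.
    suc*conv-suc : ∀ n → ℕ⇒ℚ (suc n) * conv α β (suc n) ≡ (p + q) * conv α β n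
    suc*conv-suc n = begin
      ℕ⇒ℚ (suc n) * conv α β (suc n)
        ≡⟨ ∑-* (ℕ⇒ℚ (suc n)) (suc n) _ ⟩
      ∑[ j ≤ suc n ] (ℕ⇒ℚ (suc n) * (α j * β (suc n ∸ j)))
        ≡⟨ ∑-cong (suc n) (λ j j≤ →
             trans (cong (λ k → ℕ⇒ℚ k * (α j * β (suc n ∸ j))) (sym (ℕₚ.m+[n∸m]≡n j≤)))
             (trans (cong (_* (α j * β (suc n ∸ j))) (ℕ⇒ℚ-+ j (suc n ∸ j)))
               (*-distribʳ-+ (α j * β (suc n ∸ j)) (ℕ⇒ℚ j) (ℕ⇒ℚ (suc n ∸ j))))) ⟩
      ∑[ j ≤ suc n ] (l j + r j)
        ≡⟨ ∑-+ (suc n) l r ⟩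
      ∑≤ (suc n) l + ∑≤ (suc n) r
        ≡⟨ cong₂ _+_ left right ⟩
      p * conv α β n + q * conv α β n
        ≡⟨ sym (*-distribʳ-+ (conv α β n) p q) ⟩
      (p + q) * conv α β n ∎
      where
      open ≡-Reasoning
      open +-*-Solver
      l r : ℕ → ℚ
      l j = ℕ⇒ℚ j * (α j * β (suc n ∸ j))
      r j = ℕ⇒ℚ (suc n ∸ j) * (α j * β (suc n ∸ j))
      left : ∑≤ (suc n) l ≡ p * conv α β n
      left = begin
        ∑≤ (suc n) l                   ≡⟨ ∑-head n l ⟩
        l 0 + (∑[ j ≤ n ] l (suc j))
          ≡⟨ cong₂ _+_ (*-zeroˡ (α 0 * β (suc n))) (∑-cong n λ j _ →
               trans (sym (*-assoc (ℕ⇒ℚ (suc j)) (α (suc j)) (β (n ∸ j))))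
               (trans (cong (_* β (n ∸ j)) (α-suc j)) (*-assoc p (α j) (β (n ∸ j))))) ⟩
        0ℚ + (∑[ j ≤ n ] (p * (α j * β (n ∸ j))))  ≡⟨ +-identityˡ _ ⟩
        ∑[ j ≤ n ] (p * (α j * β (n ∸ j)))         ≡⟨ sym (∑-* p n _) ⟩
        p * conv α β n                 ∎
      right : ∑≤ (suc n) r ≡ q * conv α β n
      right = begin
        ∑≤ n r + r (suc n)
          ≡⟨ cong₂ _+_ (∑-cong n λ j j≤n →
               trans (cong (λ k → ℕ⇒ℚ k * (α j * β k)) (ℕₚ.+-∸-assoc 1 j≤n))
               (trans (solve 3 (λ s a b → s :* (a :* b) := a :* (s :* b)) refl
                         (ℕ⇒ℚ (suc (n ∸ j))) (α j) (β (suc (n ∸ j))))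
               (trans (cong (α j *_) (β-suc (n ∸ j)))
                 (solve 3 (λ a q b → a :* (q :* b) := q :* (a :* b)) refl (α j) q (β (n ∸ j))))))
               (trans (cong (λ k → ℕ⇒ℚ k * (α (suc n) * β k)) (ℕₚ.n∸n≡0 n))
                 (*-zeroˡ (α (suc n) * β 0))) ⟩
        (∑[ j ≤ n ] (q * (α j * β (n ∸ j)))) + 0ℚ  ≡⟨ +-identityʳ _ ⟩
        ∑[ j ≤ n ] (q * (α j * β (n ∸ j)))         ≡⟨ sym (∑-* q n _) ⟩
        q * conv α β n                 ∎

  -- Both sides start at 1 and satisfy (n + 1) t(n + 1) = (p + q) t(n), which replaces the binomial
  -- theorem.
  term-+ : ∀ p q n → term (p + q) n ≡ conv (term p) (term q) n
  term-+ p q zero    = refl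
  term-+ p q (suc n) = begin
    term (p + q) (suc n)               ≡⟨ term-suc (p + q) n ⟩
    (i * (p + q)) * term (p + q) n     ≡⟨ cong ((i * (p + q)) *_) (term-+ p q n) ⟩
    (i * (p + q)) * c n                ≡⟨ *-assoc i (p + q) (c n) ⟩
    i * ((p + q) * c n)
      ≡⟨ cong (i *_) (sym (suc*conv-suc {term p} {term q} {p} {q} (suc*term-suc p) (suc*term-suc q) n)) ⟩
    i * (ℕ⇒ℚ (suc n) * c (suc n))      ≡⟨ sym (*-assoc i (ℕ⇒ℚ (suc n)) (c (suc n))) ⟩
    (i * ℕ⇒ℚ (suc n)) * c (suc n)
      ≡⟨ cong (_* c (suc n)) (trans (*-comm i (ℕ⇒ℚ (suc n))) (1/-inverse (suc n))) ⟩
    1ℚ * c (suc n)                     ≡⟨ *-identityˡ (c (suc n)) ⟩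
    c (suc n)                          ∎
    where
    open ≡-Reasoning
    c = conv (term p) (term q)
    i = + 1 / suc n

  partialExp-+ : ∀ p q N → partialExp (p + q) N ≡ conv (term p) (partialExp q) N
  partialExp-+ p q N = trans (∑-cong N λ n _ → term-+ p q n) (∑-conv (term p) (term q) N)

  -- Finite differences and the recurrence for the coefficients

  Δ : ℕ → (ℕ → ℚ) → ℚ
  Δ k g = ∑[ j ≤ k ] (ℕ⇒ℚ (k C j) * (- 1ℚ) ^ (k ∸ j) * g j)

  Δ-cong : ∀ k {g h : ℕ → ℚ} → (∀ j → g j ≡ h j) → Δ k g ≡ Δ k h
  Δ-cong k g≡h = ∑-cong k λ j _ → cong (ℕ⇒ℚ (k C j) * (- 1ℚ) ^ (k ∸ j) *_) (g≡h j)

  Δ-+ : ∀ k (g h : ℕ → ℚ) → Δ k (λ j → g j + h j) ≡ Δ k g + Δ k h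
  Δ-+ k g h = trans (∑-cong k λ j _ → *-distribˡ-+ (ℕ⇒ℚ (k C j) * (- 1ℚ) ^ (k ∸ j)) (g j) (h j))
    (∑-+ k _ _)

  Δ-conv : ∀ k α (β : ℕ → ℕ → ℚ) n →
           Δ k (λ j → conv α (β j) n) ≡ conv α (λ i → Δ k (λ j → β j i)) n
  Δ-conv k α β n = trans (∑-cong k λ j _ → conv-*ʳ (w j) α (β j) n) (conv-∑ʳ k α (λ j i → w j * β j i) n)
    where
    w : ℕ → ℚ
    w j = ℕ⇒ℚ (k C j) * (- 1ℚ) ^ (k ∸ j)

  -- Pascal's rule splits every coefficient but the first. One part is the difference of the shifted
  -- sequence; the other, joined with `f 0`, is again a sum from 0, whose top term vanishes because
  -- `k C suc k` is 0, and the remaining power of -1 gives the minus sign.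
  Δ-suc : ∀ k (g : ℕ → ℚ) → Δ (suc k) g ≡ Δ k (g ∘ suc) - Δ k g
  Δ-suc k g = begin
    Δ (suc k) g
      ≡⟨ ∑-head k _ ⟩
    f 0 + (∑[ j ≤ k ] (ℕ⇒ℚ (suc k C suc j) * (- 1ℚ) ^ (k ∸ j) * g (suc j)))
      ≡⟨ cong (λ t → f 0 + t) (∑-cong k λ j _ → pascal j) ⟩
    f 0 + (∑[ j ≤ k ] (l j + f (suc j)))
      ≡⟨ cong (λ t → f 0 + t) (∑-+ k l (f ∘ suc)) ⟩
    f 0 + (∑≤ k l + ∑≤ k (f ∘ suc))
      ≡⟨ solve 3 (λ a b c → a :+ (b :+ c) := b :+ (a :+ c)) refl (f 0) (∑≤ k l) (∑≤ k (f ∘ suc)) ⟩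
    ∑≤ k l + (f 0 + ∑≤ k (f ∘ suc))
      ≡⟨ cong (λ t → ∑≤ k l + t) (sym (∑-head k f)) ⟩
    ∑≤ k l + (∑≤ k f + f (suc k))
      ≡⟨ cong (λ t → ∑≤ k l + t) (cong₂ _+_ (∑-cong k negate) f-last) ⟩
    ∑≤ k l + ((∑[ j ≤ k ] (- 1ℚ * (ℕ⇒ℚ (k C j) * (- 1ℚ) ^ (k ∸ j) * g j))) + 0ℚ)
      ≡⟨ cong (λ t → ∑≤ k l + t) (trans (+-identityʳ _) (sym (∑-* (- 1ℚ) k _))) ⟩
    ∑≤ k l + - 1ℚ * Δ k g
      ≡⟨ cong (λ t → ∑≤ k l + t) (solve 1 (λ d → con (- 1ℚ) :* d := :- d) refl (Δ k g)) ⟩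
    Δ k (g ∘ suc) - Δ k g ∎
    where
    open ≡-Reasoning
    open +-*-Solver
    f l : ℕ → ℚ
    f j = ℕ⇒ℚ (k C j) * (- 1ℚ) ^ (suc k ∸ j) * g j
    l j = ℕ⇒ℚ (k C j) * (- 1ℚ) ^ (k ∸ j) * g (suc j)
    pascal : ∀ j → ℕ⇒ℚ (suc k C suc j) * (- 1ℚ) ^ (k ∸ j) * g (suc j) ≡ l j + f (suc j)
    pascal j = trans
      (cong (λ c → c * (- 1ℚ) ^ (k ∸ j) * g (suc j))
        (trans (cong ℕ⇒ℚ (sym (nCk+nC[k+1]≡[n+1]C[k+1] k j))) (ℕ⇒ℚ-+ (k C j) (k C suc j))))
      (solve 4 (λ a b s g → (a :+ b) :* s :* g := a :* s :* g :+ b :* s :* g) refl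
        (ℕ⇒ℚ (k C j)) (ℕ⇒ℚ (k C suc j)) ((- 1ℚ) ^ (k ∸ j)) (g (suc j)))
    negate : ∀ j → j ℕ.≤ k → f j ≡ - 1ℚ * (ℕ⇒ℚ (k C j) * (- 1ℚ) ^ (k ∸ j) * g j)
    negate j j≤k = trans
      (cong (λ i → ℕ⇒ℚ (k C j) * (- 1ℚ) ^ i * g j) (ℕₚ.+-∸-assoc 1 j≤k))
      (solve 4 (λ o c s g → c :* (o :* s) :* g := o :* (c :* s :* g)) refl
        (- 1ℚ) (ℕ⇒ℚ (k C j)) ((- 1ℚ) ^ (k ∸ j)) (g j))
    f-last : f (suc k) ≡ 0ℚ
    f-last = trans
      (cong (λ c → ℕ⇒ℚ c * (- 1ℚ) ^ (k ∸ k) * g (suc k)) (k>n⇒nCk≡0 (ℕₚ.n<1+n k)))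
      (solve 2 (λ s g → con 0ℚ :* s :* g := con 0ℚ) refl ((- 1ℚ) ^ (k ∸ k)) (g (suc k)))

  -- Δ-term q b k n is the coefficient of order n of exp b (exp q - 1)ᵏ.
  Δ-term : ℚ → ℚ → ℕ → ℕ → ℚ
  Δ-term q b k n = Δ k (λ j → term (ℕ⇒ℚ j * q + b) n)

  module _ (q b : ℚ) where

    private
      d = Δ-term q b

      e : ℕ → ℚ
      e i = term q (suc i)

    Δ-term-0 : ∀ n → d 0 n ≡ term b n
    Δ-term-0 n = trans (*-identityˡ (term (0ℚ * q + b) n))
      (cong (λ w → term w n) (trans (cong (_+ b) (*-zeroˡ q)) (+-identityˡ b)))

    Δ-term-suc-0 : ∀ k → d (suc k) 0 ≡ 0ℚ
    Δ-term-suc-0 k = trans (Δ-suc k λ j → term (ℕ⇒ℚ j * q + b) 0) (+-inverseʳ (Δ k λ _ → 1ℚ))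

    -- A step from j to j + 1 multiplies the series by exp q. Its constant term 1 gives the first
    -- summand; `e` lists the coefficients of exp q - 1 from order 1 on.
    term-shift : ∀ j n → term (ℕ⇒ℚ (suc j) * q + b) (suc n) ≡
      term (ℕ⇒ℚ j * q + b) (suc n) + conv e (term (ℕ⇒ℚ j * q + b)) n
    term-shift j n = begin
      term (ℕ⇒ℚ (suc j) * q + b) (suc n)
        ≡⟨ cong (λ w → term w (suc n)) (trans (cong (λ i → i * q + b) (ℕ⇒ℚ-+ 1 j))
             (solve 3 (λ j q b → (con 1ℚ :+ j) :* q :+ b := q :+ (j :* q :+ b)) refl (ℕ⇒ℚ j) q b)) ⟩
      term (q + w) (suc n)                             ≡⟨ term-+ q w (suc n) ⟩
      conv (term q) (term w) (suc n)
        ≡⟨ ∑-head n (λ i → term q i * term w (suc n ∸ i)) ⟩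
      1ℚ * term w (suc n) + conv e (term w) n
        ≡⟨ cong (_+ conv e (term w) n) (*-identityˡ (term w (suc n))) ⟩
      term w (suc n) + conv e (term w) n               ∎
      where
      open ≡-Reasoning
      open +-*-Solver
      w = ℕ⇒ℚ j * q + b

    -- The difference cancels the constant term of exp q and leaves a factor exp q - 1. This factor
    -- begins at order 1, so the order drops together with `k`.
    Δ-term-suc-suc : ∀ k n → d (suc k) (suc n) ≡ conv e (d k) n
    Δ-term-suc-suc k n = begin
      d (suc k) (suc n)                     ≡⟨ Δ-suc k g ⟩
      Δ k (g ∘ suc) - Δ k g                 ≡⟨ cong (_- Δ k g) (Δ-cong k λ j → term-shift j n) ⟩
      Δ k (λ j → g j + h j) - Δ k g         ≡⟨ cong (_- Δ k g) (Δ-+ k g h) ⟩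
      (Δ k g + Δ k h) - Δ k g
        ≡⟨ solve 2 (λ a b → (a :+ b) :+ :- a := b) refl (Δ k g) (Δ k h) ⟩
      Δ k h                                 ≡⟨ Δ-conv k e (λ j → term (ℕ⇒ℚ j * q + b)) n ⟩
      conv e (d k) n                        ∎
      where
      open ≡-Reasoning
      open +-*-Solver
      g h : ℕ → ℚ
      g j = term (ℕ⇒ℚ j * q + b) (suc n)
      h j = conv e (term (ℕ⇒ℚ j * q + b)) n

    Δ-term-vanishes : ∀ {k n} → n ℕ.< k → d k n ≡ 0ℚ
    Δ-term-vanishes {suc k} {zero}  _         = Δ-term-suc-0 k
    Δ-term-vanishes {suc k} {suc n} (s≤s n<k) = trans (Δ-term-suc-suc k n) (trans
      (∑-cong n λ j _ → trans (cong (e j *_) (Δ-term-vanishes (ℕₚ.≤-<-trans (ℕₚ.m∸n≤m n j) n<k)))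
        (trans (*-zeroʳ (e j)) (sym (*-zeroˡ 0ℚ))))
      (trans (sym (∑-* 0ℚ n (λ _ → 0ℚ))) (*-zeroˡ (∑≤ n λ _ → 0ℚ))))

    module _ (y : ℚ) where

      coeff : ℕ → ℚ
      coeff n = ∑[ k ≤ n ] (y ^ k * d k n)

      kernel : ℕ → ℚ
      kernel i = y * e i

      -- Lets coefficients of different orders share one range of `k`, so that the sum over `k` can
      -- be moved inside a convolution.
      coeff-extend : ∀ {n N} → n ℕ.≤ N → ∑[ k ≤ N ] (y ^ k * d k n) ≡ coeff n
      coeff-extend {n} {N} n≤N =
        trans (cong (λ i → ∑[ k ≤ i ] (y ^ k * d k n)) (sym (ℕₚ.m∸n+n≡m n≤N)))
          (∑-truncate (N ∸ n) (λ k → y ^ k * d k n) λ k n<k →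
            trans (cong (y ^ k *_) (Δ-term-vanishes n<k)) (*-zeroʳ (y ^ k)))

      -- The equation U = exp b + y (exp q - 1) U read off coefficientwise: the summand k = 0 is exp
      -- b, and every other summand releases one factor `kernel`.
      coeff-suc : ∀ n → coeff (suc n) ≡ term b (suc n) + conv kernel coeff n
      coeff-suc n = begin
        coeff (suc n)
          ≡⟨ ∑-head n (λ k → y ^ k * d k (suc n)) ⟩
        1ℚ * d 0 (suc n) + (∑[ k ≤ n ] ((y * y ^ k) * d (suc k) (suc n)))
          ≡⟨ cong₂ _+_ (trans (*-identityˡ (d 0 (suc n))) (Δ-term-0 (suc n))) (∑-cong n λ k _ → step k) ⟩
        term b (suc n) + (∑[ k ≤ n ] conv kernel (λ i → y ^ k * d k i) n)
          ≡⟨ cong (λ t → term b (suc n) + t) (conv-∑ʳ n kernel (λ k i → y ^ k * d k i) n) ⟩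
        term b (suc n) + conv kernel (λ i → ∑[ k ≤ n ] (y ^ k * d k i)) n
          ≡⟨ cong (λ t → term b (suc n) + t) (conv-cong {kernel} n (λ _ → refl) λ _ → coeff-extend) ⟩
        term b (suc n) + conv kernel coeff n ∎
        where
        open ≡-Reasoning
        step : ∀ k → (y * y ^ k) * d (suc k) (suc n) ≡ conv kernel (λ i → y ^ k * d k i) n
        step k = begin
          (y * y ^ k) * d (suc k) (suc n)     ≡⟨ cong ((y * y ^ k) *_) (Δ-term-suc-suc k n) ⟩
          (y * y ^ k) * conv e (d k) n        ≡⟨ *-assoc y (y ^ k) _ ⟩
          y * (y ^ k * conv e (d k) n)        ≡⟨ cong (y *_) (conv-*ʳ (y ^ k) e (d k) n) ⟩
          y * conv e (λ i → y ^ k * d k i) n  ≡⟨ conv-*ˡ y e (λ i → y ^ k * d k i) n ⟩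
          conv kernel (λ i → y ^ k * d k i) n ∎

      ∑coeff-suc : ∀ N → ∑≤ (suc N) coeff ≡ partialExp b (suc N) + conv kernel (λ n → ∑≤ n coeff) N
      ∑coeff-suc N = begin
        ∑≤ (suc N) coeff                                             ≡⟨ ∑-head N coeff ⟩
        coeff 0 + (∑[ n ≤ N ] coeff (suc n))
          ≡⟨ cong (λ t → coeff 0 + t)
               (trans (∑-cong N λ n _ → coeff-suc n) (∑-+ N (term b ∘ suc) (conv kernel coeff))) ⟩
        1ℚ + ((∑[ n ≤ N ] term b (suc n)) + ∑≤ N (conv kernel coeff))
          ≡⟨ sym (+-assoc 1ℚ (∑[ n ≤ N ] term b (suc n)) (∑≤ N (conv kernel coeff))) ⟩
        (1ℚ + (∑[ n ≤ N ] term b (suc n))) + ∑≤ N (conv kernel coeff)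
          ≡⟨ cong₂ _+_ (sym (∑-head N (term b))) (∑-conv kernel coeff N) ⟩
        partialExp b (suc N) + conv kernel (λ n → ∑≤ n coeff) N      ∎
        where open ≡-Reasoning

  -- Whitney numbers and Tanny-Dowling polynomials at rational arguments

  ℕ⇒ℚ-* : ∀ m n → ℕ⇒ℚ (m ℕ.* n) ≡ ℕ⇒ℚ m * ℕ⇒ℚ n
  ℕ⇒ℚ-* m n = trans (cong (_/ 1) (ℤₚ.pos-* m n)) (sym (/-* (+ m) 1 (+ n) 1))

  term-* : ∀ c w n → term (c * w) n ≡ c ^ n * term w n
  term-* c w n = trans (cong (i *_) (^-distrib-* c w n))
    (solve 3 (λ i c w → i :* (c :* w) := c :* (i :* w)) refl i (c ^ n) (w ^ n))
    where
    open +-*-Solver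
    i = (+ 1 / n !) {{ℕₚ._!≢0 n}}

  module _ (m : ℕ) .{{m≢0 : ℕ.NonZero m}} where

    private
      m^k≢0 : ∀ k → ℕ.NonZero (m ℕ.^ k)
      m^k≢0 k = ℕₚ.m^n≢0 m k
      m^k*k!≢0 : ∀ k → ℕ.NonZero (m ℕ.^ k ℕ.* k !)
      m^k*k!≢0 k = ℕₚ.m*n≢0 (m ℕ.^ k) (k !) {{m^k≢0 k}} {{ℕₚ._!≢0 k}}

    1/^ : ∀ k → (+ 1 / m ℕ.^ k) {{m^k≢0 k}} ≡ (+ 1 / m) ^ k
    1/^ zero    = refl
    1/^ (suc k) = trans (sym (/-* (+ 1) m (+ 1) (m ℕ.^ k) {{m≢0}} {{m^k≢0 k}} {{m^k≢0 (suc k)}}))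
      (cong ((+ 1 / m) *_) (1/^ k))

    !*1/^*! : ∀ k → ℕ⇒ℚ (k !) * (+ 1 / (m ℕ.^ k ℕ.* k !)) {{m^k*k!≢0 k}} ≡ (+ 1 / m) ^ k
    !*1/^*! k = begin
      f * (+ 1 / (m ℕ.^ k ℕ.* k !)) {{m^k*k!≢0 k}}
        ≡⟨ cong (f *_) (sym (/-* (+ 1) (m ℕ.^ k) (+ 1) (k !) {{m^k≢0 k}} {{ℕₚ._!≢0 k}} {{m^k*k!≢0 k}})) ⟩
      f * (p * g)          ≡⟨ solve 3 (λ f p g → f :* (p :* g) := p :* (f :* g)) refl f p g ⟩
      p * (f * g)          ≡⟨ cong₂ _*_ (1/^ k) (1/-inverse (k !) {{ℕₚ._!≢0 k}}) ⟩
      (+ 1 / m) ^ k * 1ℚ   ≡⟨ *-identityʳ _ ⟩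
      (+ 1 / m) ^ k        ∎
      where
      open ≡-Reasoning
      open +-*-Solver
      f = ℕ⇒ℚ (k !)
      p = (+ 1 / m ℕ.^ k) {{m^k≢0 k}}
      g = (+ 1 / k !) {{ℕₚ._!≢0 k}}

    -- The rational instances of W̃ and F̃.
    whitney : ℚ → ℕ → ℕ → ℚ
    whitney a n k = (+ 1 / (m ℕ.^ k ℕ.* k !)) {{m^k*k!≢0 k}} * Δ k (λ j → (ℕ⇒ℚ (m ℕ.* j) - a) ^ n)

    tannyDowling : ℚ → ℕ → ℚ → ℚ
    tannyDowling a n x = ∑[ k ≤ n ] (ℕ⇒ℚ (k !) * whitney a n k * x ^ k)

    module _ (a x z : ℚ) where

      private
        q = ℕ⇒ℚ m * z
        b = - (a * z)
        y = (+ 1 / m) * x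

      -- The factor zⁿ/n! turns the power (mj - a)ⁿ into `term` at (mj - a) z = j q + b, a
      -- progression of step q.
      whitney*z^ : ∀ n k → Δ k (λ j → (ℕ⇒ℚ (m ℕ.* j) - a) ^ n) * term z n ≡ Δ-term q b k n
      whitney*z^ n k = trans (*-comm (Δ k (λ j → (ℕ⇒ℚ (m ℕ.* j) - a) ^ n)) (term z n))
        (trans (∑-* (term z n) k _) (∑-cong k λ j _ →
          trans (solve 3 (λ t w g → t :* (w :* g) := w :* (g :* t)) refl
                  (term z n) (ℕ⇒ℚ (k C j) * (- 1ℚ) ^ (k ∸ j)) ((ℕ⇒ℚ (m ℕ.* j) - a) ^ n))
            (cong (ℕ⇒ℚ (k C j) * (- 1ℚ) ^ (k ∸ j) *_)
              (trans (sym (term-* (ℕ⇒ℚ (m ℕ.* j) - a) z n)) (cong (λ w → term w n) (arg j))))))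
        where
        open +-*-Solver
        arg : ∀ j → (ℕ⇒ℚ (m ℕ.* j) - a) * z ≡ ℕ⇒ℚ j * q + b
        arg j = trans (cong (λ i → (i - a) * z) (ℕ⇒ℚ-* m j))
          (solve 4 (λ m j a z → (m :* j :+ :- a) :* z := j :* (m :* z) :+ :- (a :* z)) refl
            (ℕ⇒ℚ m) (ℕ⇒ℚ j) a z)

      -- The factorial k! cancels against the normalisation of the Whitney number, and the surviving
      -- m⁻ᵏ combines with xᵏ to yᵏ.
      tannyDowling*z^ : ∀ n → tannyDowling a n x * term z n ≡ coeff q b y n
      tannyDowling*z^ n = trans (*-comm (tannyDowling a n x) (term z n))
        (trans (∑-* (term z n) n _) (∑-cong n λ k _ → step k))
        where
        open +-*-Solver
        step : ∀ k → term z n * (ℕ⇒ℚ (k !) * whitney a n k * x ^ k) ≡ y ^ k * Δ-term q b k n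
        step k = trans
          (solve 5 (λ t f i d x → t :* (f :* (i :* d) :* x) := ((f :* i) :* x) :* (d :* t)) refl
            (term z n) (ℕ⇒ℚ (k !)) ((+ 1 / (m ℕ.^ k ℕ.* k !)) {{m^k*k!≢0 k}})
            (Δ k (λ j → (ℕ⇒ℚ (m ℕ.* j) - a) ^ n)) (x ^ k))
          (cong₂ _*_ (trans (cong (_* x ^ k) (!*1/^*! k)) (sym (^-distrib-* (+ 1 / m) x k)))
            (whitney*z^ n k))

  -- Bounds for sums, powers and convolutions

  +-bound : ∀ {p q a b} → ∣ p ∣ ≤ a → ∣ q ∣ ≤ b → ∣ p + q ∣ ≤ a + b
  +-bound {p} {q} p≤a q≤b = ≤-trans (∣p+q∣≤∣p∣+∣q∣ p q) (+-mono-≤ p≤a q≤b)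

  *-bound : ∀ {p q a b} → ∣ p ∣ ≤ a → ∣ q ∣ ≤ b → ∣ p * q ∣ ≤ a * b
  *-bound {p} {q} p≤a q≤b = ≤-trans (≤-reflexive (∣p*q∣≡∣p∣*∣q∣ p q))
    (*-mono (0≤∣p∣ p) (≤-trans (0≤∣p∣ q) q≤b) p≤a q≤b)

  ∑-bound : ∀ n {f g : ℕ → ℚ} → (∀ k → k ℕ.≤ n → ∣ f k ∣ ≤ g k) → ∣ ∑≤ n f ∣ ≤ ∑≤ n g
  ∑-bound zero    f≤g = f≤g 0 z≤n
  ∑-bound (suc n) f≤g =
    +-bound (∑-bound n λ k k≤n → f≤g k (ℕₚ.m≤n⇒m≤1+n k≤n)) (f≤g (suc n) ℕₚ.≤-refl)

  p≤p+q : ∀ {p q} → 0ℚ ≤ q → p ≤ p + q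
  p≤p+q {p} {q} 0≤q = subst (_≤ p + q) (+-identityʳ p) (+-monoʳ-≤ p 0≤q)

  q≤p+q : ∀ {p q} → 0ℚ ≤ p → q ≤ p + q
  q≤p+q {p} {q} 0≤p = subst (_≤ p + q) (+-identityˡ q) (+-monoˡ-≤ q 0≤p)

  ∑-nonNeg : ∀ n {f : ℕ → ℚ} → (∀ k → 0ℚ ≤ f k) → 0ℚ ≤ ∑≤ n f
  ∑-nonNeg zero    0≤f = 0≤f 0
  ∑-nonNeg (suc n) 0≤f = +-mono-≤ (∑-nonNeg n 0≤f) (0≤f (suc n))

  term≤∑ : ∀ {k n} {f : ℕ → ℚ} → (∀ k → 0ℚ ≤ f k) → k ℕ.≤ n → f k ≤ ∑≤ n f
  term≤∑ {n = zero}  0≤f z≤n = ≤-refl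
  term≤∑ {n = suc n} 0≤f k≤1+n with ℕₚ.m≤n⇒m<n∨m≡n k≤1+n
  ... | inj₁ (s≤s k≤n) = ≤-trans (term≤∑ 0≤f k≤n) (p≤p+q (0≤f (suc n)))
  ... | inj₂ refl      = q≤p+q (∑-nonNeg n 0≤f)

  ^-nonNeg : ∀ {p} k → 0ℚ ≤ p → 0ℚ ≤ p ^ k
  ^-nonNeg zero    0≤p = nonNegative⁻¹ 1ℚ
  ^-nonNeg (suc k) 0≤p = *-nonNeg 0≤p (^-nonNeg k 0≤p)

  ^-mono : ∀ {p q} k → 0ℚ ≤ p → p ≤ q → p ^ k ≤ q ^ k
  ^-mono zero    0≤p p≤q = ≤-refl
  ^-mono (suc k) 0≤p p≤q =
    *-mono 0≤p (^-nonNeg k (≤-trans 0≤p p≤q)) p≤q (^-mono k 0≤p p≤q)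

  halve : ∀ n → ½ ^ suc n + ½ ^ suc n ≡ ½ ^ n
  halve n = ½+½ (½ ^ n)

  0≤½^ : ∀ n → 0ℚ ≤ ½ ^ n
  0≤½^ n = ^-nonNeg n (nonNegative⁻¹ ½)

  ½^≤1 : ∀ n → ½ ^ n ≤ 1ℚ
  ½^≤1 zero    = ≤-refl
  ½^≤1 (suc n) = ≤-trans (≤-trans (p≤p+q (0≤½^ (suc n))) (≤-reflexive (halve n))) (½^≤1 n)

  ¼≤½ : ¼ ≤ ½
  ¼≤½ = toWitness {a? = ¼ ≤? ½} _

  ¼^≤½^ : ∀ n → ¼ ^ n ≤ ½ ^ n
  ¼^≤½^ n = ^-mono n (nonNegative⁻¹ ¼) ¼≤½

  ¼^j*½^[n∸j] : ∀ {j n} → j ℕ.≤ n → ¼ ^ j * ½ ^ (n ∸ j) ≡ ½ ^ j * ½ ^ n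
  ¼^j*½^[n∸j] {j} {n} j≤n = trans (cong (_* ½ ^ (n ∸ j)) (^-distrib-* ½ ½ j))
    (trans (*-assoc (½ ^ j) (½ ^ j) (½ ^ (n ∸ j)))
      (cong (½ ^ j *_) (trans (sym (^-homo-* ½ j (n ∸ j))) (cong (½ ^_) (ℕₚ.m+[n∸m]≡n j≤n)))))

  ∑½^ : ∀ n → (∑[ j ≤ n ] ½ ^ j) + ½ ^ n ≡ 1ℚ + 1ℚ
  ∑½^ zero    = refl
  ∑½^ (suc n) = trans (+-assoc (∑[ j ≤ n ] ½ ^ j) (½ ^ suc n) (½ ^ suc n))
    (trans (cong (λ t → ∑≤ n (½ ^_) + t) (halve n)) (∑½^ n))

  -- Since ¼ʲ ½ⁿ⁻ʲ = ½ʲ ½ⁿ, a kernel decaying like ¼ʲ leaves the weight ½ⁿ intact and costs only ∑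
  -- ½ʲ ≤ 2.
  conv-bound : ∀ {α β A B} n → (∀ j → ∣ α j ∣ ≤ A * ¼ ^ j) → (∀ j → j ℕ.≤ n → ∣ β j ∣ ≤ B * ½ ^ j) →
               ∣ conv α β n ∣ ≤ (A * B) * (½ ^ n + ½ ^ n)
  conv-bound {α} {β} {A} {B} n α≤ β≤ = begin
    ∣ conv α β n ∣
      ≤⟨ ∑-bound n (λ j j≤n → *-bound (α≤ j) (β≤ (n ∸ j) (ℕₚ.m∸n≤m n j))) ⟩
    ∑[ j ≤ n ] ((A * ¼ ^ j) * (B * ½ ^ (n ∸ j)))
      ≡⟨ ∑-cong n (λ j j≤n → trans
           (solve 4 (λ a q b h → (a :* q) :* (b :* h) := (a :* b) :* (q :* h)) refl
             A (¼ ^ j) B (½ ^ (n ∸ j)))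
           (trans (cong (A * B *_) (¼^j*½^[n∸j] j≤n))
           (solve 3 (λ c h k → c :* (h :* k) := (c :* k) :* h) refl (A * B) (½ ^ j) (½ ^ n)))) ⟩
    ∑[ j ≤ n ] ((A * B * ½ ^ n) * ½ ^ j)
      ≡⟨ sym (∑-* (A * B * ½ ^ n) n (½ ^_)) ⟩
    (A * B * ½ ^ n) * ∑≤ n (½ ^_)
      ≤⟨ *-monoˡ (A * B * ½ ^ n) (*-nonNeg (*-nonNeg 0≤A 0≤B) (0≤½^ n)) ∑≤2 ⟩
    (A * B * ½ ^ n) * (1ℚ + 1ℚ)
      ≡⟨ solve 2 (λ c h → (c :* h) :* (con 1ℚ :+ con 1ℚ) := c :* (h :+ h)) refl (A * B) (½ ^ n) ⟩
    (A * B) * (½ ^ n + ½ ^ n) ∎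
    where
    open ≤-Reasoning
    open +-*-Solver
    -- The signs of `A` and `B` are read off from the two bounds at index 0.
    0≤A = ≤-trans (0≤∣p∣ (α 0)) (≤-trans (α≤ 0) (≤-reflexive (*-identityʳ A)))
    0≤B = ≤-trans (0≤∣p∣ (β 0)) (≤-trans (β≤ 0 z≤n) (≤-reflexive (*-identityʳ B)))
    ∑≤2 : ∑≤ n (½ ^_) ≤ 1ℚ + 1ℚ
    ∑≤2 = ≤-trans (p≤p+q (0≤½^ n)) (≤-reflexive (∑½^ n))

  module _ {f : ℕ → ℚ} {A : ℚ} (0≤A : 0ℚ ≤ A) (f≤ : ∀ k → ∣ f (suc k) ∣ ≤ A * ½ ^ suc k) where

    -- The extra summand on the left is the part of the geometric tail not yet used. It makes the
    -- induction close: each new term consumes half of what was left.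
    ∑-tail+ : ∀ d n → ∣ ∑≤ (d ℕ.+ n) f - ∑≤ n f ∣ + A * ½ ^ (d ℕ.+ n) ≤ A * ½ ^ n
    ∑-tail+ zero    n = ≤-reflexive
      (trans (cong (λ u → ∣ u ∣ + A * ½ ^ n) (+-inverseʳ (∑≤ n f))) (+-identityˡ (A * ½ ^ n)))
    ∑-tail+ (suc d) n = begin
      ∣ (s₁ + u) - s₀ ∣ + g′
        ≡⟨ cong (λ v → ∣ v ∣ + g′)
             (solve 3 (λ e u f → (e :+ u) :+ :- f := (e :+ :- f) :+ u) refl s₁ u s₀) ⟩
      ∣ (s₁ - s₀) + u ∣ + g′
        ≤⟨ +-monoˡ-≤ g′ (+-bound {s₁ - s₀} {u} ≤-refl (f≤ (d ℕ.+ n))) ⟩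
      (∣ s₁ - s₀ ∣ + g′) + g′
        ≡⟨ solve 3 (λ v a h → (v :+ a :* h) :+ a :* h := v :+ a :* (h :+ h)) refl
             ∣ s₁ - s₀ ∣ A (½ ^ suc (d ℕ.+ n)) ⟩
      ∣ s₁ - s₀ ∣ + A * (½ ^ suc (d ℕ.+ n) + ½ ^ suc (d ℕ.+ n))
        ≡⟨ cong (λ h → ∣ s₁ - s₀ ∣ + A * h) (halve (d ℕ.+ n)) ⟩
      ∣ s₁ - s₀ ∣ + A * ½ ^ (d ℕ.+ n)   ≤⟨ ∑-tail+ d n ⟩
      A * ½ ^ n                         ∎
      where
      open ≤-Reasoning
      open +-*-Solver
      s₀ = ∑≤ n f
      s₁ = ∑≤ (d ℕ.+ n) f
      u  = f (suc (d ℕ.+ n))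
      g′ = A * ½ ^ suc (d ℕ.+ n)

    ∑-tail : ∀ {m n} → n ℕ.≤ m → ∣ ∑≤ n f - ∑≤ m f ∣ ≤ A * ½ ^ n
    ∑-tail {m} {n} n≤m = subst (_≤ A * ½ ^ n) (∣-∣-comm (∑≤ m f) (∑≤ n f))
      (subst (λ i → ∣ ∑≤ i f - ∑≤ n f ∣ ≤ A * ½ ^ n) (ℕₚ.m∸n+n≡m n≤m)
        (≤-trans (p≤p+q (*-nonNeg 0≤A (0≤½^ (m ∸ n ℕ.+ n)))) (∑-tail+ (m ∸ n) n)))

  -- With r as the error of the partial sums, a kernel of norm ½ in the weights 2ⁿ
  -- reproduces the bound (A + A) ½ⁿ.
  contraction : ∀ {A} {κ r η : ℕ → ℚ} {M} → (∀ j → ∣ κ j ∣ ≤ (½ * ¼) * ¼ ^ j) →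
    ∣ r 0 ∣ ≤ A + A → (∀ n → n ℕ.< M → r (suc n) ≡ η n + conv κ r n) →
    (∀ n → n ℕ.< M → ∣ η n ∣ ≤ A * ½ ^ suc n) → ∀ n → n ℕ.≤ M → ∣ r n ∣ ≤ (A + A) * ½ ^ n
  contraction {A} {κ} {r} {η} {M} κ≤ r₀≤ r-suc η≤ n n≤M = upTo n n≤M n ℕₚ.≤-refl
    where
    open +-*-Solver
    -- The convolution reaches back to all earlier errors, so the induction carries the bound for
    -- every k ≤ n.
    upTo : ∀ n → n ℕ.≤ M → ∀ k → k ℕ.≤ n → ∣ r k ∣ ≤ (A + A) * ½ ^ k
    upTo zero    _   zero z≤n = ≤-trans r₀≤ (≤-reflexive (sym (*-identityʳ (A + A))))
    upTo (suc n) n<M k    k≤  with ℕₚ.m≤n⇒m<n∨m≡n k≤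
    ... | inj₁ (s≤s k≤n) = upTo n (ℕₚ.<⇒≤ n<M) k k≤n
    ... | inj₂ refl      = begin
      ∣ r (suc n) ∣          ≡⟨ cong ∣_∣ (r-suc n n<M) ⟩
      ∣ η n + conv κ r n ∣
        ≤⟨ +-bound {η n} {conv κ r n} (η≤ n n<M) (conv-bound {A = ½ * ¼} {B = A + A} n κ≤ (upTo n (ℕₚ.<⇒≤ n<M))) ⟩
      A * ½ ^ suc n + ((½ * ¼) * (A + A)) * (½ ^ n + ½ ^ n)
        ≡⟨ cong (λ h → A * g + (e * (A + A)) * (h + h)) (sym (halve n)) ⟩
      A * g + (e * (A + A)) * ((g + g) + (g + g))
        -- Here `e` is ⅛, and its eight copies evaluate to 1: the convolution contributes exactly
        -- the second `A`, the first being the share of `η`.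
        ≡⟨ solve 3 (λ a t e → a :* t :+ (e :* (a :+ a)) :* ((t :+ t) :+ (t :+ t)) :=
             a :* t :+ (((e :+ e) :+ (e :+ e)) :+ ((e :+ e) :+ (e :+ e))) :* (a :* t)) refl A g e ⟩
      A * g + 1ℚ * (A * g)
        ≡⟨ trans (cong (λ s → A * g + s) (*-identityˡ (A * g))) (sym (*-distribʳ-+ g A A)) ⟩
      (A + A) * ½ ^ suc n    ∎
      where
      open ≤-Reasoning
      g = ½ ^ suc n
      e = ½ * ¼

  -- Decay of the powers of ½

  archimedean : ∀ {δ} → 0ℚ < δ → ∃[ D ] 1ℚ ≤ ℕ⇒ℚ D * δ
  archimedean {δ} 0<δ = ℤ.∣ ↥ (1/ δ) ∣ , subst (_≤ ℕ⇒ℚ ℤ.∣ ↥ (1/ δ) ∣ * δ) (*-inverseˡ δ)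
    (*-monoʳ-≤-nonNeg δ {{nonNegative (<⇒≤ 0<δ)}} (≤-trans (p≤∣p∣ (1/ δ)) (∣p∣≤ℕ (1/ δ))))
    where instance _ = >-nonZero 0<δ

  -- Takes the place of a logarithm: comparing ½ⁿ with 1/(n + 1) gives ½ⁿ ≤ δ as soon as n is at
  -- least some D with 1 ≤ D δ.
  suc*½^≤1 : ∀ n → ℕ⇒ℚ (suc n) * ½ ^ n ≤ 1ℚ
  suc*½^≤1 zero    = ≤-refl
  suc*½^≤1 (suc n) = begin
    ℕ⇒ℚ (2 ℕ.+ n) * ½ ^ suc n    ≡⟨ cong (_* ½ ^ suc n) (ℕ⇒ℚ-+ 1 (suc n)) ⟩
    (1ℚ + s) * (½ * h)
      ≡⟨ solve 4 (λ o s t h → (o :+ s) :* (t :* h) := t :* (o :* h :+ s :* h)) refl 1ℚ s ½ h ⟩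
    ½ * (1ℚ * h + s * h)         ≡⟨ cong (λ g → ½ * (g + s * h)) (*-identityˡ h) ⟩
    ½ * (h + s * h)              ≤⟨ *-monoˡ ½ (nonNegative⁻¹ ½) (+-mono-≤ (½^≤1 n) (suc*½^≤1 n)) ⟩
    1ℚ                           ∎
    where
    open ≤-Reasoning
    open +-*-Solver
    s = ℕ⇒ℚ (suc n)
    h = ½ ^ n

  ½^≤ : ∀ {D δ} → 0ℚ < δ → 1ℚ ≤ ℕ⇒ℚ D * δ → ∀ n → D ℕ.≤ n → ½ ^ n ≤ δ
  ½^≤ {D} {δ} 0<δ 1≤Dδ n D≤n = begin
    h                        ≡⟨ sym (*-identityʳ h) ⟩
    h * 1ℚ                   ≤⟨ *-monoˡ h (0≤½^ n) 1≤Dδ ⟩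
    h * (ℕ⇒ℚ D * δ)          ≡⟨ solve 3 (λ h d e → h :* (d :* e) := (h :* e) :* d) refl h (ℕ⇒ℚ D) δ ⟩
    (h * δ) * ℕ⇒ℚ D          ≤⟨ *-monoˡ (h * δ) (*-nonNeg (0≤½^ n) 0≤δ) D≤suc ⟩
    (h * δ) * ℕ⇒ℚ (suc n)    ≡⟨ solve 3 (λ h e d → (h :* e) :* d := e :* (d :* h)) refl h δ (ℕ⇒ℚ (suc n)) ⟩
    δ * (ℕ⇒ℚ (suc n) * h)    ≤⟨ *-monoˡ δ 0≤δ (suc*½^≤1 n) ⟩
    δ * 1ℚ                   ≡⟨ *-identityʳ δ ⟩
    δ                        ∎
    where
    open ≤-Reasoning
    open +-*-Solver
    h = ½ ^ n
    0≤δ = <⇒≤ 0<δ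
    D≤suc : ℕ⇒ℚ D ≤ ℕ⇒ℚ (suc n)
    D≤suc = ≤-trans (p≤p+q (0≤ℕ⇒ℚ (suc n ∸ D))) (≤-reflexive
      (trans (sym (ℕ⇒ℚ-+ D (suc n ∸ D))) (cong ℕ⇒ℚ (ℕₚ.m+[n∸m]≡n (ℕₚ.m≤n⇒m≤1+n D≤n)))))

  ½^-small : ∀ G {ε} → 0ℚ < ε → ∃[ N ] (∀ n → N ℕ.≤ n → G * ½ ^ n < ε)
  ½^-small G {ε} 0<ε =
    let B = ℤ.∣ ↥ G ∣
        δ , 0<δ , Bδ<ε = shrink B 0<ε
        D , 1≤Dδ = archimedean 0<δ
    in D , λ n D≤n → ≤-<-trans (≤-trans
         (*-monoʳ-≤-nonNeg (½ ^ n) {{nonNegative (0≤½^ n)}} (≤-trans (p≤∣p∣ G) (∣p∣≤ℕ G)))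
         (*-monoˡ (ℕ⇒ℚ B) (0≤ℕ⇒ℚ B) (½^≤ {D} 0<δ 1≤Dδ n D≤n))) Bδ<ε

  -- Estimates for truncated exponentials

  ⅛ : ℚ
  ⅛ = ½ * ¼

  p≤q*p : ∀ {p q} → 0ℚ ≤ p → 1ℚ ≤ q → p ≤ q * p
  p≤q*p {p} {q} 0≤p 1≤q = subst (_≤ q * p) (*-identityˡ p) (*-monoʳ-≤-nonNeg p {{nonNegative 0≤p}} 1≤q)

  1/suc≤1 : ∀ k → + 1 / suc k ≤ 1ℚ
  1/suc≤1 k = subst (+ 1 / suc k ≤_) (1/-inverse (suc k)) (p≤q*p (0≤1/ (suc k))
    (≤-trans (p≤p+q (0≤ℕ⇒ℚ k)) (≤-reflexive (sym (ℕ⇒ℚ-+ 1 k)))))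

  ∣term-suc∣ : ∀ q k {c} → ∣ term q k ∣ ≤ c → ∣ term q (suc k) ∣ ≤ ∣ q ∣ * c
  ∣term-suc∣ q k {c} t≤c = begin
    ∣ term q (suc k) ∣                  ≡⟨ cong ∣_∣ (term-suc q k) ⟩
    ∣ ((+ 1 / suc k) * q) * term q k ∣
      ≤⟨ *-bound {(+ 1 / suc k) * q} {term q k}
           (*-bound {+ 1 / suc k} {q} (≤-trans (≤-reflexive (0≤p⇒∣p∣≡p (0≤1/ (suc k)))) (1/suc≤1 k)) ≤-refl)
           t≤c ⟩
    (1ℚ * ∣ q ∣) * c                    ≡⟨ cong (_* c) (*-identityˡ ∣ q ∣) ⟩
    ∣ q ∣ * c                           ∎
    where open ≤-Reasoning

  ∣term∣≤^ : ∀ {q r} → ∣ q ∣ ≤ r → ∀ k → ∣ term q k ∣ ≤ r ^ k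
  ∣term∣≤^         q≤r zero    = ≤-refl
  ∣term∣≤^ {q} {r} q≤r (suc k) = ≤-trans (∣term-suc∣ q k (∣term∣≤^ q≤r k))
    (*-monoʳ-≤-nonNeg (r ^ k) {{nonNegative (^-nonNeg k (≤-trans (0≤∣p∣ q) q≤r))}} q≤r)

  partialExp-near-0 : ∀ {q} → ∣ q ∣ ≤ ½ → ∀ n → ∣ 1ℚ - partialExp q n ∣ ≤ ∣ q ∣ + ∣ q ∣
  partialExp-near-0 {q} q≤½ n =
    subst (∣ 1ℚ - partialExp q n ∣ ≤_) (*-identityʳ (∣ q ∣ + ∣ q ∣))
      (∑-tail {term q} (+-mono-≤ (0≤∣p∣ q) (0≤∣p∣ q)) (λ k →
        ≤-trans (∣term-suc∣ q k (∣term∣≤^ q≤½ k)) (≤-reflexive (double k))) (z≤n {n}))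
    where
    open +-*-Solver
    double : ∀ k → ∣ q ∣ * ½ ^ k ≡ (∣ q ∣ + ∣ q ∣) * ½ ^ suc k
    double k = trans (cong (∣ q ∣ *_) (sym (halve k)))
      (solve 2 (λ a h → a :* (h :+ h) := (a :+ a) :* h) refl ∣ q ∣ (½ ^ suc k))

  term-nonNeg : ∀ {q} → 0ℚ ≤ q → ∀ k → 0ℚ ≤ term q k
  term-nonNeg 0≤q k = *-nonNeg (0≤1/ (k !) {{ℕₚ._!≢0 k}}) (^-nonNeg k 0≤q)

  term-suc≤ : ∀ {q} → 0ℚ ≤ q → ∀ k → term q (suc k) ≤ q * term q k
  term-suc≤ {q} 0≤q k = ≤-trans (p≤∣p∣ (term q (suc k)))
    (≤-trans (∣term-suc∣ q k (≤-reflexive (0≤p⇒∣p∣≡p (term-nonNeg 0≤q k))))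
      (≤-reflexive (cong (_* term q k) (0≤p⇒∣p∣≡p 0≤q))))

  1+q≤partialExp : ∀ {q} → 0ℚ ≤ q → ∀ n → 1ℚ + q ≤ partialExp q (suc n)
  1+q≤partialExp {q} 0≤q zero    = ≤-reflexive
    (cong (λ t → 1ℚ + t) (sym (trans (*-identityˡ (q * 1ℚ)) (*-identityʳ q))))
  1+q≤partialExp {q} 0≤q (suc n) =
    ≤-trans (1+q≤partialExp 0≤q n) (p≤p+q (term-nonNeg 0≤q (2 ℕ.+ n)))

  -- Holds term by term after the constant term 1, because (k + 1)! ≥ k!.
  partialExp-suc≤ : ∀ {q} → 0ℚ ≤ q → ∀ n → partialExp q (suc n) ≤ 1ℚ + q * partialExp q n
  partialExp-suc≤ {q} 0≤q zero    = +-monoʳ-≤ 1ℚ (term-suc≤ 0≤q 0)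
  partialExp-suc≤ {q} 0≤q (suc n) =
    ≤-trans (+-mono-≤ (partialExp-suc≤ 0≤q n) (term-suc≤ 0≤q (suc n)))
      (≤-reflexive (trans (+-assoc 1ℚ (q * partialExp q n) (q * term q (suc n)))
        (cong (λ t → 1ℚ + t) (sym (*-distribˡ-+ q (partialExp q n) (term q (suc n)))))))

  partialExp≤1+q*partialExp : ∀ {q} → 0ℚ ≤ q → ∀ n → partialExp q n ≤ 1ℚ + q * partialExp q n
  partialExp≤1+q*partialExp {q} 0≤q n =
    ≤-trans (p≤p+q (term-nonNeg 0≤q (suc n))) (partialExp-suc≤ 0≤q n)

  module _ (B : ℕ) where

    private
      K′ = Rational.K B
      t′ = Rational.t B

    t-decreasing : ∀ d → t′ (d ℕ.+ K′) ≤ t′ K′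
    t-decreasing zero    = ≤-refl
    t-decreasing (suc d) = ≤-trans (p≤p+q (0≤t B (suc d ℕ.+ K′)))
      (≤-trans (t-halves B (ℕₚ.m≤n+m K′ d)) (t-decreasing d))

    -- The sum stands in for a maximum: a term up to `K′` is one of its summands, and a later one is
    -- at most the last summand.
    t-bounded : ∀ k → t′ k ≤ ∑≤ K′ t′
    t-bounded k with ℕₚ.≤-total k K′
    ... | inj₁ k≤K = term≤∑ {k} {K′} (0≤t B) k≤K
    ... | inj₂ K≤k = ≤-trans (subst (λ i → t′ i ≤ t′ K′) (ℕₚ.m∸n+n≡m K≤k) (t-decreasing (k ∸ K′)))
      (term≤∑ {K′} {K′} (0≤t B) ℕₚ.≤-refl)

  -- By scaling: the term at q is ¼ᵏ times the term at 4q, and the terms at 4q are bounded uniformly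
  -- for |q| ≤ B. Hence the argument `4 ℕ.* B` in the constant.
  term-geometric : ∀ B → ∃[ G ] (∀ q → ∣ q ∣ ≤ ℕ⇒ℚ B → ∀ k → ∣ term q k ∣ ≤ G * ¼ ^ k)
  term-geometric B = G , bound
    where
    G = ∑≤ (Rational.K (4 ℕ.* B)) (Rational.t (4 ℕ.* B))
    bound : ∀ q → ∣ q ∣ ≤ ℕ⇒ℚ B → ∀ k → ∣ term q k ∣ ≤ G * ¼ ^ k
    bound q q≤B k = begin
      ∣ term q k ∣                           ≡⟨ cong (λ w → ∣ term w k ∣) (sym ¼*4q) ⟩
      ∣ term (¼ * (ℕ⇒ℚ 4 * q)) k ∣           ≡⟨ cong ∣_∣ (term-* ¼ (ℕ⇒ℚ 4 * q) k) ⟩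
      ∣ ¼ ^ k * term (ℕ⇒ℚ 4 * q) k ∣
        ≤⟨ *-bound {¼ ^ k} {term (ℕ⇒ℚ 4 * q) k}
             (≤-reflexive (0≤p⇒∣p∣≡p (^-nonNeg k (nonNegative⁻¹ ¼))))
             (≤-trans (∣term∣≤t (4 ℕ.* B) 4q≤ k) (t-bounded (4 ℕ.* B) k)) ⟩
      ¼ ^ k * G                              ≡⟨ *-comm (¼ ^ k) G ⟩
      G * ¼ ^ k                              ∎
      where
      open ≤-Reasoning
      ¼*4q : ¼ * (ℕ⇒ℚ 4 * q) ≡ q
      ¼*4q = trans (sym (*-assoc ¼ (ℕ⇒ℚ 4) q)) (*-identityˡ q)
      4q≤ : ∣ ℕ⇒ℚ 4 * q ∣ ≤ ℕ⇒ℚ (4 ℕ.* B)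
      4q≤ = ≤-trans (*-bound {ℕ⇒ℚ 4} {q} ≤-refl q≤B) (≤-reflexive (sym (ℕ⇒ℚ-* 4 B)))

  -- The truncation at N of exp (p + q) pairs the j-th term of exp p with the partial sum of exp q
  -- up to N - j, the product with that up to N. The defect is a convolution of terms with tails,
  -- both geometric.
  partialExp-* : ∀ B → ∃[ G ] (∀ p q → ∣ p ∣ ≤ ℕ⇒ℚ B → ∣ q ∣ ≤ ℕ⇒ℚ B → ∀ N →
    ∣ partialExp (p + q) N - partialExp p N * partialExp q N ∣ ≤ G * ½ ^ N)
  partialExp-* B = G * G + G * G , bound
    where
    G = proj₁ (term-geometric B)
    geometric = proj₂ (term-geometric B)
    0≤G : 0ℚ ≤ G
    0≤G = ≤-trans (0≤∣p∣ (term 0ℚ 0))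
      (≤-trans (geometric 0ℚ (0≤ℕ⇒ℚ B) 0) (≤-reflexive (*-identityʳ G)))
    bound : ∀ p q → ∣ p ∣ ≤ ℕ⇒ℚ B → ∣ q ∣ ≤ ℕ⇒ℚ B → ∀ N →
      ∣ partialExp (p + q) N - partialExp p N * partialExp q N ∣ ≤ (G * G + G * G) * ½ ^ N
    bound p q p≤B q≤B N = begin
      ∣ partialExp (p + q) N - partialExp p N * X ∣
        ≡⟨ cong ∣_∣ difference ⟩
      ∣ conv (term p) (λ k → partialExp q k - X) N ∣
        ≤⟨ conv-bound {A = G} {B = G} N (geometric p p≤B) (λ k k≤N → ∑-tail {term q} 0≤G (λ j →
             ≤-trans (geometric q q≤B (suc j)) (*-monoˡ G 0≤G (¼^≤½^ (suc j)))) k≤N) ⟩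
      (G * G) * (½ ^ N + ½ ^ N)
        ≡⟨ solve 2 (λ c h → c :* (h :+ h) := (c :+ c) :* h) refl (G * G) (½ ^ N) ⟩
      (G * G + G * G) * ½ ^ N ∎
      where
      open ≤-Reasoning
      open +-*-Solver
      X = partialExp q N
      difference : partialExp (p + q) N - partialExp p N * X ≡ conv (term p) (λ k → partialExp q k - X) N
      difference = begin-equality
        partialExp (p + q) N - partialExp p N * X
          ≡⟨ cong₂ _+_ (partialExp-+ p q N)
               (trans (solve 2 (λ s x → :- (s :* x) := (:- x) :* s) refl (partialExp p N) X)
               (trans (∑-* (- X) N (term p)) (∑-cong N λ k _ → *-comm (- X) (term p k)))) ⟩
        conv (term p) (partialExp q) N + conv (term p) (λ _ → - X) N
          ≡⟨ sym (conv-+ʳ (term p) (partialExp q) (λ _ → - X) N) ⟩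
        conv (term p) (λ k → partialExp q k - X) N ∎

  -- Clamping at ½ makes the reciprocal total, nonnegative and at most 2 on every approximant,
  -- including those before a lower bound takes effect.
  recip : ℚ → ℚ
  recip q = (1/ (½ ⊔ q)) {{pos⇒nonZero (½ ⊔ q) {{positive (<-≤-trans (positive⁻¹ ½) (p≤p⊔q ½ q))}}}}

  recip-nonNeg : ∀ q → 0ℚ ≤ recip q
  recip-nonNeg q = <⇒≤ (positive⁻¹ (recip q) {{1/pos⇒pos (½ ⊔ q) {{½⊔q>0}}}})
    where ½⊔q>0 = positive (<-≤-trans (positive⁻¹ ½) (p≤p⊔q ½ q))

  recip-inverse⊔ : ∀ q → (½ ⊔ q) * recip q ≡ 1ℚ
  recip-inverse⊔ q = *-inverseʳ (½ ⊔ q)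
    {{pos⇒nonZero (½ ⊔ q) {{positive (<-≤-trans (positive⁻¹ ½) (p≤p⊔q ½ q))}}}}

  recip-inverse : ∀ {q} → ½ ≤ q → q * recip q ≡ 1ℚ
  recip-inverse {q} ½≤q = subst (λ r → r * recip q ≡ 1ℚ) (p≤q⇒p⊔q≡q ½≤q) (recip-inverse⊔ q)

  recip≤2 : ∀ q → recip q ≤ ℕ⇒ℚ 2
  recip≤2 q = begin
    recip q                       ≡⟨ sym (*-identityˡ (recip q)) ⟩
    (ℕ⇒ℚ 2 * ½) * recip q         ≡⟨ *-assoc (ℕ⇒ℚ 2) ½ (recip q) ⟩
    ℕ⇒ℚ 2 * (½ * recip q)
      ≤⟨ *-monoˡ (ℕ⇒ℚ 2) (0≤ℕ⇒ℚ 2) (*-monoʳ-≤-nonNeg (recip q) {{nonNegative (recip-nonNeg q)}} (p≤p⊔q ½ q)) ⟩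
    ℕ⇒ℚ 2 * ((½ ⊔ q) * recip q)   ≡⟨ cong (ℕ⇒ℚ 2 *_) (recip-inverse⊔ q) ⟩
    ℕ⇒ℚ 2                         ∎
    where open ≤-Reasoning

  ∣recip∣≤2 : ∀ q → ∣ recip q ∣ ≤ ℕ⇒ℚ 2
  ∣recip∣≤2 q = ≤-trans (≤-reflexive (0≤p⇒∣p∣≡p (recip-nonNeg q))) (recip≤2 q)

  recip-lipschitz : ∀ {p q} → ½ ≤ p → ½ ≤ q → ∣ recip p - recip q ∣ ≤ ℕ⇒ℚ 4 * ∣ p - q ∣
  recip-lipschitz {p} {q} ½≤p ½≤q = begin
    ∣ rp - rq ∣                        ≡⟨ cong ∣_∣ difference ⟩
    ∣ (rp * rq) * (q - p) ∣
      ≤⟨ *-bound {rp * rq} {q - p} (*-bound {rp} {rq} (∣recip∣≤2 p) (∣recip∣≤2 q)) ≤-refl ⟩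
    (ℕ⇒ℚ 2 * ℕ⇒ℚ 2) * ∣ q - p ∣        ≡⟨ cong (ℕ⇒ℚ 4 *_) (∣-∣-comm q p) ⟩
    ℕ⇒ℚ 4 * ∣ p - q ∣                  ∎
    where
    open ≤-Reasoning
    open +-*-Solver
    rp = recip p
    rq = recip q
    difference : rp - rq ≡ (rp * rq) * (q - p)
    difference = begin-equality
      rp - rq                          ≡⟨ cong₂ _-_ (sym (*-identityʳ rp)) (sym (*-identityʳ rq)) ⟩
      rp * 1ℚ - rq * 1ℚ
        ≡⟨ cong₂ (λ a b → rp * a - rq * b) (sym (recip-inverse ½≤q)) (sym (recip-inverse ½≤p)) ⟩
      rp * (q * rq) - rq * (p * rp)
        ≡⟨ solve 4 (λ a b p q → a :* (q :* b) :+ :- (b :* (p :* a)) := (a :* b) :* (q :+ :- p)) refl rp rq p q ⟩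
      (rp * rq) * (q - p)              ∎

  -- Geometric convergence to the fixed point at rational arguments

  ∣p-q∣-bound : ∀ {p q a b} → ∣ p ∣ ≤ a → ∣ q ∣ ≤ b → ∣ p - q ∣ ≤ a + b
  ∣p-q∣-bound {p} {q} p≤a q≤b = ≤-trans (∣p-q∣≤∣p∣+∣q∣ p q) (+-mono-≤ p≤a q≤b)

  module _ {q b y : ℚ} (b≤½ : ∣ b ∣ ≤ ½) (q≤¼ : ∣ q ∣ ≤ ¼) (yq≤⅛ : ∣ y * q ∣ ≤ ⅛) where

    private
      κ = kernel q b y

      P : ℕ → ℚ
      P n = ∑≤ n κ

      S : ℕ → ℚ
      S n = ∑≤ n (coeff q b y)

    0≤⅛ : 0ℚ ≤ ⅛
    0≤⅛ = nonNegative⁻¹ ⅛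

    -- One of the j + 1 factors q is spent together with y on the bound ⅛; the other j give the
    -- powers of ¼.
    kernel-bound : ∀ j → ∣ κ j ∣ ≤ ⅛ * ¼ ^ j
    kernel-bound j = begin
      ∣ y * term q (suc j) ∣
        ≡⟨ cong ∣_∣ (trans (cong (y *_) (term-suc q j))
             (solve 4 (λ y i q t → y :* ((i :* q) :* t) := (i :* (y :* q)) :* t) refl
               y (+ 1 / suc j) q (term q j))) ⟩
      ∣ ((+ 1 / suc j) * (y * q)) * term q j ∣
        ≤⟨ *-bound {(+ 1 / suc j) * (y * q)} {term q j}
             (*-bound {+ 1 / suc j} {y * q} (≤-trans (≤-reflexive (0≤p⇒∣p∣≡p (0≤1/ (suc j)))) (1/suc≤1 j)) yq≤⅛)
             (∣term∣≤^ q≤¼ j) ⟩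
      (1ℚ * ⅛) * ¼ ^ j
        ≡⟨ cong (_* ¼ ^ j) (*-identityˡ ⅛) ⟩
      ⅛ * ¼ ^ j ∎
      where
      open ≤-Reasoning
      open +-*-Solver

    ∑kernel : ∀ n → P n ≡ y * (partialExp q (suc n) - 1ℚ)
    ∑kernel n = trans (sym (∑-* y n (λ i → term q (suc i)))) (cong (y *_) (sym
      (trans (cong (_- 1ℚ) (∑-head n (term q)))
        (solve 2 (λ o s → (o :+ s) :+ :- o := s) refl 1ℚ (∑[ i ≤ n ] term q (suc i))))))
      where open +-*-Solver

    ∑kernel-tail : ∀ {m n} → n ℕ.≤ m → ∣ P n - P m ∣ ≤ ⅛ * ½ ^ n
    ∑kernel-tail = ∑-tail {κ} 0≤⅛ λ k → ≤-trans (kernel-bound (suc k)) (*-monoˡ ⅛ 0≤⅛ (¼^≤½^ (suc k)))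

    ½≤1-∑kernel : ∀ n → ½ ≤ 1ℚ - y * (partialExp q (suc n) - 1ℚ)
    ½≤1-∑kernel n = subst (λ p → ½ ≤ 1ℚ - p) (∑kernel n)
      (+-monoʳ-≤ 1ℚ (neg-antimono-≤ (≤-trans (p≤∣p∣ (P n)) P≤½)))
      where
      open +-*-Solver
      P≤½ : ∣ P n ∣ ≤ ½
      P≤½ = ≤-trans (subst (λ p → ∣ p ∣ ≤ ⅛ * 1ℚ + ⅛ * 1ℚ)
          (solve 2 (λ a b → a :+ :- (a :+ :- b) := b) refl (P 0) (P n))
          (∣p-q∣-bound {P 0} {P 0 - P n} (kernel-bound 0) (∑kernel-tail {n} z≤n)))
        (toWitness {a? = ⅛ * 1ℚ + ⅛ * 1ℚ ≤? ½} _)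

    module _ {κ⁻¹ : ℚ} {i : ℕ} (∣κ⁻¹∣≤2 : ∣ κ⁻¹ ∣ ≤ ℕ⇒ℚ 2)
             (inverse : (1ℚ - y * (partialExp q (suc i) - 1ℚ)) * κ⁻¹ ≡ 1ℚ) where

      private
        E : ℕ → ℚ
        E = partialExp b

        s = E (suc i) * κ⁻¹

      -- Here `κ⁻¹` inverts 1 - P i, so `s` solves s = E (suc i) + s P i exactly. Subtracting this
      -- from the recurrence for the partial sums leaves a convolution of the errors plus `η`, which
      -- consists only of tails between n and i. The bound is free of i.
      ∑coeff-error : ∀ n → n ℕ.≤ suc i → ∣ S n - s ∣ ≤ (ℕ⇒ℚ 3 + ℕ⇒ℚ 3) * ½ ^ n
      -- The constant A = 3 has to meet two demands: |S 0 - s| ≤ 1 + 4 ≤ 2A, and |η n| ≤ (1 + 4 (⅛ +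
      -- ⅛)) ½ⁿ⁺¹ = 2 ½ⁿ⁺¹ ≤ A ½ⁿ⁺¹.
      ∑coeff-error = contraction {ℕ⇒ℚ 3} {κ} {λ n → S n - s} {η} kernel-bound r₀ r-suc η-bound
        where
        open ≤-Reasoning
        open +-*-Solver
        η : ℕ → ℚ
        η n = (E (suc n) - E (suc i)) + s * (P n - P i)
        ∣E∣≤2 : ∣ E (suc i) ∣ ≤ ℕ⇒ℚ 2
        ∣E∣≤2 = subst (λ p → ∣ p ∣ ≤ ℕ⇒ℚ 2)
          (solve 2 (λ o e → o :+ :- (o :+ :- e) := e) refl 1ℚ (E (suc i)))
          (∣p-q∣-bound {1ℚ} {1ℚ - E (suc i)} ≤-refl
            (≤-trans (partialExp-near-0 b≤½ (suc i)) (+-mono-≤ b≤½ b≤½)))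
        ∣s∣≤4 : ∣ s ∣ ≤ ℕ⇒ℚ 4
        ∣s∣≤4 = *-bound {E (suc i)} {κ⁻¹} ∣E∣≤2 ∣κ⁻¹∣≤2
        r₀ : ∣ S 0 - s ∣ ≤ ℕ⇒ℚ 3 + ℕ⇒ℚ 3
        r₀ = ≤-trans (∣p-q∣-bound {1ℚ} {s} ≤-refl ∣s∣≤4) (toWitness {a? = 1ℚ + ℕ⇒ℚ 4 ≤? ℕ⇒ℚ 3 + ℕ⇒ℚ 3} _)
        s-fixed : s ≡ E (suc i) + s * P i
        s-fixed = begin-equality
          s                            ≡⟨ solve 2 (λ s p → s := s :* (con 1ℚ :+ :- p) :+ s :* p) refl s (P i) ⟩
          s * (1ℚ - P i) + s * P i
            ≡⟨ cong (_+ s * P i) (trans (cong (λ p → s * (1ℚ - p)) (∑kernel i))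
                 (trans (solve 3 (λ e k c → (e :* k) :* c := e :* (c :* k)) refl (E (suc i)) κ⁻¹ _)
                 (trans (cong (E (suc i) *_) inverse) (*-identityʳ (E (suc i)))))) ⟩
          E (suc i) + s * P i          ∎
        r-suc : ∀ n → n ℕ.< suc i → S (suc n) - s ≡ η n + conv κ (λ n → S n - s) n
        r-suc n _ = begin-equality
          S (suc n) - s
            ≡⟨ cong₂ _-_ (∑coeff-suc q b y n) s-fixed ⟩
          (E (suc n) + conv κ S n) - (E (suc i) + s * P i)
            ≡⟨ solve 6 (λ e c f s p r → (e :+ c) :+ :- (f :+ s :* p) :=
                 ((e :+ :- f) :+ s :* (r :+ :- p)) :+ (c :+ (:- s) :* r)) refl
                 (E (suc n)) (conv κ S n) (E (suc i)) s (P i) (P n) ⟩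
          η n + (conv κ S n + (- s) * P n)
            ≡⟨ cong (λ t → η n + (conv κ S n + t))
                 (trans (∑-* (- s) n κ) (∑-cong n λ j _ → *-comm (- s) (κ j))) ⟩
          η n + (conv κ S n + conv κ (λ _ → - s) n)
            ≡⟨ cong (λ t → η n + t) (sym (conv-+ʳ κ S (λ _ → - s) n)) ⟩
          η n + conv κ (λ n → S n - s) n ∎
        η-bound : ∀ n → n ℕ.< suc i → ∣ η n ∣ ≤ ℕ⇒ℚ 3 * ½ ^ suc n
        η-bound n (s≤s n≤i) = begin
          ∣ η n ∣
            ≤⟨ +-bound {E (suc n) - E (suc i)} {s * (P n - P i)}
                 (∑-tail {term b} (nonNegative⁻¹ 1ℚ) (λ k → ≤-trans (∣term∣≤^ b≤½ (suc k))
                   (≤-reflexive (sym (*-identityˡ (½ ^ suc k))))) (s≤s n≤i))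
                 (*-bound {s} {P n - P i} ∣s∣≤4 (∑kernel-tail n≤i)) ⟩
          1ℚ * h + ℕ⇒ℚ 4 * (⅛ * ½ ^ n)
            ≡⟨ cong (λ t → 1ℚ * h + ℕ⇒ℚ 4 * (⅛ * t)) (sym (halve n)) ⟩
          1ℚ * h + ℕ⇒ℚ 4 * (⅛ * (h + h))
            ≡⟨ solve 4 (λ o h f e → o :* h :+ f :* (e :* (h :+ h)) := (o :+ f :* (e :+ e)) :* h) refl
                 1ℚ h (ℕ⇒ℚ 4) ⅛ ⟩
          (1ℚ + ℕ⇒ℚ 4 * (⅛ + ⅛)) * h
            ≤⟨ *-monoʳ-≤-nonNeg h {{nonNegative (0≤½^ (suc n))}}
                 (toWitness {a? = 1ℚ + ℕ⇒ℚ 4 * (⅛ + ⅛) ≤? ℕ⇒ℚ 3} _) ⟩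
          ℕ⇒ℚ 3 * h ∎
          where h = ½ ^ suc n

  -- How small z has to be

  ∣1/m∣≤1 : ∀ m .{{_ : ℕ.NonZero m}} → ∣ + 1 / m ∣ ≤ 1ℚ
  ∣1/m∣≤1 (suc m) = ≤-trans (≤-reflexive (0≤p⇒∣p∣≡p (0≤1/ (suc m)))) (1/suc≤1 m)

  ℕ⇒ℚ-mono : ∀ {k n} → k ℕ.≤ n → ℕ⇒ℚ k ≤ ℕ⇒ℚ n
  ℕ⇒ℚ-mono {k} {n} k≤n = ≤-trans (p≤p+q (0≤ℕ⇒ℚ (n ∸ k)))
    (≤-reflexive (trans (sym (ℕ⇒ℚ-+ k (n ∸ k))) (cong ℕ⇒ℚ (ℕₚ.m+[n∸m]≡n k≤n))))

  module _ {m : ℕ} .{{_ : ℕ.NonZero m}} {A X : ℕ} {δ a x z : ℚ}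
           (small : ℕ⇒ℚ (A ℕ.+ (m ℕ.+ X ℕ.* m)) * δ < ⅛)
           (a≤A : ∣ a ∣ ≤ ℕ⇒ℚ A) (x≤X : ∣ x ∣ ≤ ℕ⇒ℚ X) (z≤δ : ∣ z ∣ ≤ δ) where

    private
      ∣c*z∣≤⅛ : ∀ {c k} → ∣ c ∣ ≤ ℕ⇒ℚ k → k ℕ.≤ A ℕ.+ (m ℕ.+ X ℕ.* m) → ∣ c * z ∣ ≤ ⅛
      ∣c*z∣≤⅛ {c} c≤k k≤ = ≤-trans (*-bound {c} {z} (≤-trans c≤k (ℕ⇒ℚ-mono k≤)) z≤δ) (<⇒≤ small)

    az≤½ : ∣ - (a * z) ∣ ≤ ½
    az≤½ = ≤-trans (≤-reflexive (∣-p∣≡∣p∣ (a * z)))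
      (≤-trans (∣c*z∣≤⅛ {a} {A} a≤A (ℕₚ.m≤m+n A _)) (toWitness {a? = ⅛ ≤? ½} _))

    mz≤¼ : ∣ ℕ⇒ℚ m * z ∣ ≤ ¼
    mz≤¼ = ≤-trans (∣c*z∣≤⅛ {ℕ⇒ℚ m} {m} (≤-reflexive (0≤p⇒∣p∣≡p (0≤ℕ⇒ℚ m)))
        (ℕₚ.≤-trans (ℕₚ.m≤m+n m (X ℕ.* m)) (ℕₚ.m≤n+m (m ℕ.+ X ℕ.* m) A)))
      (toWitness {a? = ⅛ ≤? ¼} _)

    xz≤⅛ : ∣ ((+ 1 / m) * x) * (ℕ⇒ℚ m * z) ∣ ≤ ⅛
    xz≤⅛ = subst (λ p → ∣ p ∣ ≤ ⅛) (*-assoc ((+ 1 / m) * x) (ℕ⇒ℚ m) z)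
      (∣c*z∣≤⅛ {((+ 1 / m) * x) * ℕ⇒ℚ m} {X ℕ.* m} (begin
        ∣ ((+ 1 / m) * x) * ℕ⇒ℚ m ∣
          ≤⟨ *-bound {(+ 1 / m) * x} {ℕ⇒ℚ m} (*-bound {+ 1 / m} {x} (∣1/m∣≤1 m) x≤X)
               (≤-reflexive (0≤p⇒∣p∣≡p (0≤ℕ⇒ℚ m))) ⟩
        (1ℚ * ℕ⇒ℚ X) * ℕ⇒ℚ m       ≡⟨ cong (_* ℕ⇒ℚ m) (*-identityˡ (ℕ⇒ℚ X)) ⟩
        ℕ⇒ℚ X * ℕ⇒ℚ m              ≡⟨ sym (ℕ⇒ℚ-* X m) ⟩
        ℕ⇒ℚ (X ℕ.* m)              ∎)
        (ℕₚ.≤-trans (ℕₚ.m≤n+m (X ℕ.* m) m) (ℕₚ.m≤n+m (m ℕ.+ X ℕ.* m) A)))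
      where open ≤-Reasoning

open import Defs
open Rational using (ℕ⇒ℚ; halves; ½-pos; ½+½; triangle; shrink; partialExp)

-- Equality and order of real numbers

≃-eventually : ∀ {x y} N → (∀ n → N ℕ.≤ n → seq x n ≡ seq y n) → x ≃ y
≃-eventually {x} {y} N x≡y ε 0<ε = N , λ n N≤n → subst (λ p → ℚ.∣ p ∣ ℚ.< ε)
  (sym (trans (cong (ℚ._- seq y n) (x≡y n N≤n)) (ℚₚ.+-inverseʳ (seq y n)))) 0<ε

≃-pointwise : ∀ {x y} → (∀ n → seq x n ≡ seq y n) → x ≃ y
≃-pointwise {x} {y} x≡y = ≃-eventually {x} {y} 0 λ n _ → x≡y n

≤-eventually : ∀ {x y} N → (∀ n → N ℕ.≤ n → seq x n ℚ.≤ seq y n) → x ≤ y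
≤-eventually {x} {y} N x≤y ε 0<ε = N , λ n N≤n → ℚₚ.≤-<-trans (x≤y n N≤n)
  (subst (ℚ._< seq y n ℚ.+ ε) (ℚₚ.+-identityʳ (seq y n)) (ℚₚ.+-monoʳ-< (seq y n) 0<ε))

≤-pointwise : ∀ {x y} → (∀ n → seq x n ℚ.≤ seq y n) → x ≤ y
≤-pointwise {x} {y} x≤y = ≤-eventually {x} {y} 0 λ n _ → x≤y n

≃-refl : ∀ {x} → x ≃ x
≃-refl {x} = ≃-pointwise {x} {x} λ _ → refl

≃-sym : ∀ {x y} → x ≃ y → y ≃ x
≃-sym {x} {y} x≃y ε 0<ε =
  let N , h = x≃y ε 0<ε
  in N , λ n N≤n → subst (ℚ._< ε) (Rational.∣-∣-comm (seq x n) (seq y n)) (h n N≤n)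

≃-trans : ∀ {x y z} → x ≃ y → y ≃ z → x ≃ z
≃-trans {x} {y} {z} x≃y y≃z ε 0<ε =
  let M , h = x≃y (½ ℚ.* ε) (½-pos 0<ε)
      N , k = y≃z (½ ℚ.* ε) (½-pos 0<ε)
  in M ℕ.⊔ N , λ n ≤n → ℚₚ.≤-<-trans (triangle (seq x n) (seq y n) (seq z n))
       (halves (h n (ℕₚ.m⊔n≤o⇒m≤o M N ≤n)) (k n (ℕₚ.m⊔n≤o⇒n≤o M N ≤n)))

∣p-q∣<ε⇒p<q+ε : ∀ {p q ε} → ℚ.∣ p ℚ.- q ∣ ℚ.< ε → p ℚ.< q ℚ.+ ε
∣p-q∣<ε⇒p<q+ε {p} {q} {ε} h = subst (ℚ._< q ℚ.+ ε)
  (solve 2 (λ p q → q :+ (p :+ :- q) := p) refl p q)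
  (ℚₚ.+-monoʳ-< q (ℚₚ.≤-<-trans (Rational.p≤∣p∣ (p ℚ.- q)) h))
  where open +-*-Solver

p<q+ε⇒p-q<ε : ∀ {p q ε} → p ℚ.< q ℚ.+ ε → p ℚ.- q ℚ.< ε
p<q+ε⇒p-q<ε {p} {q} {ε} h = subst (p ℚ.- q ℚ.<_)
  (solve 2 (λ q e → (q :+ e) :+ :- q := e) refl q ε) (ℚₚ.+-monoˡ-< (ℚ.- q) h)
  where open +-*-Solver

∣p∣<ε : ∀ {p ε} → p ℚ.< ε → ℚ.- p ℚ.< ε → ℚ.∣ p ∣ ℚ.< ε
∣p∣<ε {p} {ε} p<ε -p<ε with ℚₚ.∣p∣≡p∨∣p∣≡-p p
... | inj₁ e = subst (ℚ._< ε) (sym e) p<ε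
... | inj₂ e = subst (ℚ._< ε) (sym e) -p<ε

≤-reflexive : ∀ {x y} → x ≃ y → x ≤ y
≤-reflexive {x} {y} x≃y ε 0<ε =
  let N , h = x≃y ε 0<ε in N , λ n N≤n → ∣p-q∣<ε⇒p<q+ε {seq x n} (h n N≤n)

≤-trans : ∀ {x y z} → x ≤ y → y ≤ z → x ≤ z
≤-trans {x} {y} {z} x≤y y≤z ε 0<ε =
  let M , h = x≤y (½ ℚ.* ε) (½-pos 0<ε)
      N , k = y≤z (½ ℚ.* ε) (½-pos 0<ε)
  in M ℕ.⊔ N , λ n ≤n → ℚₚ.<-trans (h n (ℕₚ.m⊔n≤o⇒m≤o M N ≤n))
       (subst (seq y n ℚ.+ ½ ℚ.* ε ℚ.<_)
         (trans (ℚₚ.+-assoc (seq z n) (½ ℚ.* ε) (½ ℚ.* ε)) (cong (λ e → seq z n ℚ.+ e) (½+½ ε)))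
         (ℚₚ.+-monoˡ-< (½ ℚ.* ε) (k n (ℕₚ.m⊔n≤o⇒n≤o M N ≤n))))

≤-antisym : ∀ {x y} → x ≤ y → y ≤ x → x ≃ y
≤-antisym {x} {y} x≤y y≤x ε 0<ε =
  let M , h = x≤y ε 0<ε
      N , k = y≤x ε 0<ε
  in M ℕ.⊔ N , λ n ≤n → ∣p∣<ε {seq x n ℚ.- seq y n}
       (p<q+ε⇒p-q<ε {seq x n} (h n (ℕₚ.m⊔n≤o⇒m≤o M N ≤n)))
       (subst (ℚ._< ε) (solve 2 (λ p q → q :+ :- p := :- (p :+ :- q)) refl (seq x n) (seq y n))
         (p<q+ε⇒p-q<ε {seq y n} (k n (ℕₚ.m⊔n≤o⇒n≤o M N ≤n))))
  where open +-*-Solver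

≤-poset : Poset 0ℓ 0ℓ 0ℓ
≤-poset = record
  { Carrier = ℝ
  ; _≈_ = _≃_
  ; _≤_ = _≤_
  ; isPartialOrder = record
    { isPreorder = record
      { isEquivalence = record
        { refl  = λ {x} → ≃-refl {x}
        ; sym   = λ {x} {y} → ≃-sym {x} {y}
        ; trans = λ {x} {y} {z} → ≃-trans {x} {y} {z}
        }
      ; reflexive = λ {x} {y} → ≤-reflexive {x} {y}
      ; trans = λ {x} {y} {z} → ≤-trans {x} {y} {z}
      }
    ; antisym = λ {x} {y} → ≤-antisym {x} {y}
    }
  }

module ≤-Reasoning = PartialOrderReasoning ≤-poset

≤-<-trans : ∀ {x y z} → x ≤ y → y < z → x < z
≤-<-trans {x} {y} {z} x≤y (ε , 0<ε , N , h) =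
  let M , k = x≤y (½ ℚ.* ε) (½-pos 0<ε)
  in ½ ℚ.* ε , ½-pos 0<ε , M ℕ.⊔ N , λ n ≤n → ℚₚ.<-trans
       (subst (seq x n ℚ.+ ½ ℚ.* ε ℚ.<_)
         (trans (ℚₚ.+-assoc (seq y n) (½ ℚ.* ε) (½ ℚ.* ε)) (cong (λ e → seq y n ℚ.+ e) (½+½ ε)))
         (ℚₚ.+-monoˡ-< (½ ℚ.* ε) (k n (ℕₚ.m⊔n≤o⇒m≤o M N ≤n))))
       (h n (ℕₚ.m⊔n≤o⇒n≤o M N ≤n))

<⇒≤ : ∀ {x y} → x < y → x ≤ y
<⇒≤ {x} {y} (ε , 0<ε , N , h) = ≤-eventually {x} {y} N λ n N≤n → ℚₚ.<⇒≤
  (ℚₚ.≤-<-trans (Series.p≤p+q (ℚₚ.<⇒≤ 0<ε)) (h n N≤n))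

fromℚ-< : ∀ {p q} → p ℚ.< q → fromℚ p < fromℚ q
fromℚ-< {p} {q} p<q =
  ½ ℚ.* (q ℚ.- p) , ½-pos 0<q-p , 0 , λ _ _ → subst (p ℚ.+ ½ ℚ.* (q ℚ.- p) ℚ.<_) p+q-p≡q
    (ℚₚ.+-monoʳ-< p (subst (½ ℚ.* (q ℚ.- p) ℚ.<_) (½+½ (q ℚ.- p))
      (subst (ℚ._< ½ ℚ.* (q ℚ.- p) ℚ.+ ½ ℚ.* (q ℚ.- p)) (ℚₚ.+-identityʳ (½ ℚ.* (q ℚ.- p)))
        (ℚₚ.+-monoʳ-< (½ ℚ.* (q ℚ.- p)) (½-pos 0<q-p)))))
  where
  open +-*-Solver
  0<q-p : 0ℚ ℚ.< q ℚ.- p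
  0<q-p = subst (ℚ._< q ℚ.- p) (ℚₚ.+-inverseʳ p) (ℚₚ.+-monoˡ-< (ℚ.- p) p<q)
  p+q-p≡q : p ℚ.+ (q ℚ.- p) ≡ q
  p+q-p≡q = solve 2 (λ p q → p :+ (q :+ :- p) := q) refl p q

-- A proof of `0ℝ < ε` contains a rational gap δ, so real tolerances can be met by estimates aimed
-- at δ in ℚ.
fromℚ-between : ∀ {ε} → ((δ , _) : 0ℝ < ε) → ∀ {p} → p ℚ.< δ → fromℚ p < ε
fromℚ-between {ε} (δ , 0<δ , N , δ<ε) {p} p<δ =
  let η , 0<η , _ , p+η<δ = fromℚ-< p<δ
  in η , 0<η , N , λ n N≤n →
    ℚₚ.<-trans (p+η<δ 0 ℕ.z≤n) (subst (ℚ._< seq ε n) (ℚₚ.+-identityˡ δ) (δ<ε n N≤n))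

+-mono-≤ : ∀ {x y u v} → x ≤ y → u ≤ v → x + u ≤ y + v
+-mono-≤ {x} {y} {u} {v} x≤y u≤v ε 0<ε =
  let M , h = x≤y (½ ℚ.* ε) (½-pos 0<ε)
      N , k = u≤v (½ ℚ.* ε) (½-pos 0<ε)
  in M ℕ.⊔ N , λ n ≤n → subst (seq x n ℚ.+ seq u n ℚ.<_)
       (trans (solve 3 (λ y v e → (y :+ e) :+ (v :+ e) := (y :+ v) :+ (e :+ e)) refl
                (seq y n) (seq v n) (½ ℚ.* ε))
         (cong (λ e → (seq y n ℚ.+ seq v n) ℚ.+ e) (½+½ ε)))
       (ℚₚ.+-mono-< (h n (ℕₚ.m⊔n≤o⇒m≤o M N ≤n)) (k n (ℕₚ.m⊔n≤o⇒n≤o M N ≤n)))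
  where open +-*-Solver

neg-antimono-≤ : ∀ {x y} → x ≤ y → - y ≤ - x
neg-antimono-≤ {x} {y} x≤y ε 0<ε =
  let N , h = x≤y ε 0<ε
  in N , λ n N≤n → subst (ℚ.- seq y n ℚ.<_) (ℚₚ.+-comm ε (ℚ.- seq x n))
       (subst (ℚ._< ε ℚ.- seq x n)
         (solve 2 (λ x y → (x :+ :- y) :+ :- x := :- y) refl (seq x n) (seq y n))
         (ℚₚ.+-monoˡ-< (ℚ.- seq x n) (p<q+ε⇒p-q<ε {seq x n} (h n N≤n))))
  where open +-*-Solver

∣∣-least : ∀ {x y} → x ≤ y → - x ≤ y → ∣ x ∣ ≤ y
∣∣-least {x} {y} x≤y -x≤y ε 0<ε =
  let M , h = x≤y ε 0<ε
      N , k = -x≤y ε 0<ε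
  in M ℕ.⊔ N , λ n ≤n → ∣p∣<ε {seq x n} (h n (ℕₚ.m⊔n≤o⇒m≤o M N ≤n)) (k n (ℕₚ.m⊔n≤o⇒n≤o M N ≤n))

∣∣-cong : ∀ {x y} → x ≃ y → ∣ x ∣ ≃ ∣ y ∣
∣∣-cong {x} {y} x≃y ε 0<ε =
  let N , h = x≃y ε 0<ε
  in N , λ n N≤n → ℚₚ.≤-<-trans (Rational.∣∣p∣-∣q∣∣≤∣p-q∣ (seq x n) (seq y n)) (h n N≤n)

∣∣-+ : ∀ x y → ∣ x + y ∣ ≤ ∣ x ∣ + ∣ y ∣
∣∣-+ x y = ≤-pointwise {∣ x + y ∣} {∣ x ∣ + ∣ y ∣} λ n → ℚₚ.∣p+q∣≤∣p∣+∣q∣ (seq x n) (seq y n)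

-- A nonnegative real may have negative approximants. Replacing it by its absolute value gives an
-- equal real whose approximants are all nonnegative, so that rational inequalities apply index by
-- index.
nonNeg⇒≃∣∣ : ∀ {x} → 0ℝ ≤ x → x ≃ ∣ x ∣
nonNeg⇒≃∣∣ {x} 0≤x = ≤-antisym {x} {∣ x ∣}
  (≤-pointwise {x} {∣ x ∣} λ n → Rational.p≤∣p∣ (seq x n))
  (∣∣-least {x} {x} (≤-reflexive {x} {x} (≃-refl {x}))
    (≤-trans { - x} {0ℝ} {x} (neg-antimono-≤ {0ℝ} {x} 0≤x) 0≤x))

+-cong : ∀ {x y u v} → x ≃ y → u ≃ v → x + u ≃ y + v
+-cong {x} {y} {u} {v} x≃y u≃v = ≤-antisym {x + u} {y + v}
  (+-mono-≤ {x} {y} {u} {v} (≤-reflexive {x} {y} x≃y) (≤-reflexive {u} {v} u≃v))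
  (+-mono-≤ {y} {x} {v} {u} (≤-reflexive {y} {x} (≃-sym {x} {y} x≃y))
    (≤-reflexive {v} {u} (≃-sym {u} {v} u≃v)))

neg-cong : ∀ {x y} → x ≃ y → - x ≃ - y
neg-cong {x} {y} x≃y = ≤-antisym { - x} { - y}
  (neg-antimono-≤ {y} {x} (≤-reflexive {y} {x} (≃-sym {x} {y} x≃y)))
  (neg-antimono-≤ {x} {y} (≤-reflexive {x} {y} x≃y))

*-congˡ : ∀ r {x y} → x ≃ y → r * x ≃ r * y
*-congˡ r {x} {y} x≃y ε 0<ε =
  let B , M , r≤B = bounded r
      δ , 0<δ , Bδ<ε = shrink B 0<ε
      N , h = x≃y δ 0<δ
  in M ℕ.⊔ N , λ n ≤n → ℚₚ.≤-<-trans
       (subst (λ p → ℚ.∣ p ∣ ℚ.≤ ℕ⇒ℚ B ℚ.* δ)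
         (solve 3 (λ r x y → r :* (x :+ :- y) := r :* x :+ :- (r :* y)) refl (seq r n) (seq x n) (seq y n))
         (Series.*-bound {seq r n} {seq x n ℚ.- seq y n} (r≤B n (ℕₚ.m⊔n≤o⇒m≤o M N ≤n))
           (ℚₚ.<⇒≤ (h n (ℕₚ.m⊔n≤o⇒n≤o M N ≤n))))) Bδ<ε
  where open +-*-Solver

*-comm : ∀ x y → x * y ≃ y * x
*-comm x y = ≃-pointwise {x * y} {y * x} λ n → ℚₚ.*-comm (seq x n) (seq y n)

*-congʳ : ∀ r {x y} → x ≃ y → x * r ≃ y * r
*-congʳ r {x} {y} x≃y = ≃-trans {x * r} {r * x} {y * r} (*-comm x r)
  (≃-trans {r * x} {r * y} {y * r} (*-congˡ r {x} {y} x≃y) (*-comm r y))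

*-monoˡ-≤ : ∀ r {x y} → 0ℝ ≤ r → x ≤ y → r * x ≤ r * y
*-monoˡ-≤ r {x} {y} 0≤r x≤y = begin
  r * x        ≈⟨ *-congʳ x {r} {∣ r ∣} (nonNeg⇒≃∣∣ {r} 0≤r) ⟩
  ∣ r ∣ * x    ≤⟨ ∣r∣-mono ⟩
  ∣ r ∣ * y    ≈⟨ *-congʳ y {∣ r ∣} {r} (≃-sym {r} {∣ r ∣} (nonNeg⇒≃∣∣ {r} 0≤r)) ⟩
  r * y        ∎
  where
  open ≤-Reasoning
  ∣r∣-mono : ∣ r ∣ * x ≤ ∣ r ∣ * y
  ∣r∣-mono ε 0<ε =
    let B , M , r≤B = bounded r
        δ , 0<δ , Bδ<ε = shrink B 0<ε
        N , h = x≤y δ 0<δ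
    in M ℕ.⊔ N , λ n ≤n → let p = ℚ.∣ seq r n ∣ in ℚₚ.≤-<-trans
         (Rational.*-monoˡ p (ℚₚ.0≤∣p∣ (seq r n)) (ℚₚ.<⇒≤ (h n (ℕₚ.m⊔n≤o⇒n≤o M N ≤n))))
         (subst (ℚ._< p ℚ.* seq y n ℚ.+ ε) (sym (ℚₚ.*-distribˡ-+ p (seq y n) δ))
           (ℚₚ.+-monoʳ-< (p ℚ.* seq y n) (ℚₚ.≤-<-trans
             (ℚₚ.*-monoʳ-≤-nonNeg δ {{ℚ.nonNegative (ℚₚ.<⇒≤ 0<δ)}} (r≤B n (ℕₚ.m⊔n≤o⇒m≤o M N ≤n))) Bδ<ε)))

*-monoʳ-≤ : ∀ r {x y} → 0ℝ ≤ r → x ≤ y → x * r ≤ y * r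
*-monoʳ-≤ r {x} {y} 0≤r x≤y = begin
  x * r ≈⟨ *-comm x r ⟩
  r * x ≤⟨ *-monoˡ-≤ r {x} {y} 0≤r x≤y ⟩
  r * y ≈⟨ *-comm r y ⟩
  y * r ∎
  where open ≤-Reasoning

*-nonNeg : ∀ {x y} → 0ℝ ≤ x → 0ℝ ≤ y → 0ℝ ≤ x * y
*-nonNeg {x} {y} 0≤x 0≤y = begin
  0ℝ      ≈⟨ ≃-pointwise {0ℝ} {x * 0ℝ} (λ n → sym (ℚₚ.*-zeroʳ (seq x n))) ⟩
  x * 0ℝ  ≤⟨ *-monoˡ-≤ x {0ℝ} {y} 0≤x 0≤y ⟩
  x * y   ∎
  where open ≤-Reasoning

≤-ℕ⇒ℝ : ∀ x → ∃[ B ] x ≤ ℕ⇒ℝ B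
≤-ℕ⇒ℝ x = let B , N , x≤B = bounded x in B , ≤-eventually {x} {ℕ⇒ℝ B} N λ n N≤n →
  ℚₚ.≤-trans (Rational.p≤∣p∣ (seq x n)) (x≤B n N≤n)

0≤y-x : ∀ {x y} → x ≤ y → 0ℝ ≤ y - x
0≤y-x {x} {y} x≤y = begin
  0ℝ      ≈⟨ ≃-pointwise {0ℝ} {x - x} (λ n → sym (ℚₚ.+-inverseʳ (seq x n))) ⟩
  x - x   ≤⟨ +-mono-≤ {x} {y} { - x} { - x} x≤y (≤-reflexive { - x} { - x} (≃-refl { - x})) ⟩
  y - x   ∎
  where open ≤-Reasoning

-- The real exponential

exp-pointwise : ∀ {x y} → (∀ n → seq x n ≡ seq y n) → exp x ≃ exp y
exp-pointwise {x} {y} x≡y = ≃-pointwise {exp x} {exp y} λ n → cong (λ q → partialExp q n) (x≡y n)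

-- At index n all three exponentials are cut at degree n, and the geometric defect of `partialExp-*`
-- at that degree tends to 0.
exp-+ : ∀ x y → exp (x + y) ≃ exp x * exp y
exp-+ x y ε 0<ε =
  let B₁ , M₁ , x≤B = bounded x
      B₂ , M₂ , y≤B = bounded y
      G , error = Series.partialExp-* (B₁ ℕ.+ B₂)
      N , small = Series.½^-small G 0<ε
      B₁≤ = ℚₚ.≤-trans (Series.p≤p+q (Rational.0≤ℕ⇒ℚ B₂)) (ℚₚ.≤-reflexive (sym (Rational.ℕ⇒ℚ-+ B₁ B₂)))
      B₂≤ = ℚₚ.≤-trans (Series.q≤p+q (Rational.0≤ℕ⇒ℚ B₁)) (ℚₚ.≤-reflexive (sym (Rational.ℕ⇒ℚ-+ B₁ B₂)))
  in (M₁ ℕ.⊔ M₂) ℕ.⊔ N , λ n ≤n →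
    let M≤n = ℕₚ.m⊔n≤o⇒m≤o (M₁ ℕ.⊔ M₂) N ≤n
    in ℚₚ.≤-<-trans (error (seq x n) (seq y n)
           (ℚₚ.≤-trans (x≤B n (ℕₚ.m⊔n≤o⇒m≤o M₁ M₂ M≤n)) B₁≤)
           (ℚₚ.≤-trans (y≤B n (ℕₚ.m⊔n≤o⇒n≤o M₁ M₂ M≤n)) B₂≤) n)
         (small n (ℕₚ.m⊔n≤o⇒n≤o (M₁ ℕ.⊔ M₂) N ≤n))

exp-≃0 : ∀ {x} → x ≃ 0ℝ → exp x ≃ 1ℝ
exp-≃0 {x} x≃0 ε 0<ε =
  let M , h = x≃0 ½ (ℚₚ.positive⁻¹ ½)
      N , k = x≃0 (½ ℚ.* ε) (½-pos 0<ε)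
  in M ℕ.⊔ N , λ n ≤n →
    let q≤½ = ℚₚ.<⇒≤ (subst (λ p → ℚ.∣ p ∣ ℚ.< ½) (ℚₚ.+-identityʳ (seq x n)) (h n (ℕₚ.m⊔n≤o⇒m≤o M N ≤n)))
        q<  = subst (λ p → ℚ.∣ p ∣ ℚ.< ½ ℚ.* ε) (ℚₚ.+-identityʳ (seq x n)) (k n (ℕₚ.m⊔n≤o⇒n≤o M N ≤n))
    in subst (ℚ._< ε) (Rational.∣-∣-comm 1ℚ (partialExp (seq x n) n))
         (ℚₚ.≤-<-trans (Series.partialExp-near-0 q≤½ n) (halves q< q<))

-- Follows from the addition formula and continuity at 0, applied to y + (x - y).
exp-cong : ∀ {x y} → x ≃ y → exp x ≃ exp y
exp-cong {x} {y} x≃y = begin-equality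
  exp x                ≈⟨ exp-pointwise {x} {y + (x - y)} (λ n →
                            solve 2 (λ x y → x := y :+ (x :+ :- y)) refl (seq x n) (seq y n)) ⟩
  exp (y + (x - y))    ≈⟨ exp-+ y (x - y) ⟩
  exp y * exp (x - y)  ≈⟨ *-congˡ (exp y) {exp (x - y)} {1ℝ} (exp-≃0 {x - y} x-y≃0) ⟩
  exp y * 1ℝ           ≈⟨ ≃-pointwise {exp y * 1ℝ} {exp y} (λ n → ℚₚ.*-identityʳ (seq (exp y) n)) ⟩
  exp y                ∎
  where
  open ≤-Reasoning
  open +-*-Solver
  x-y≃0 : x - y ≃ 0ℝ
  x-y≃0 ε 0<ε = let N , h = x≃y ε 0<ε in N , λ n N≤n →
    subst (λ p → ℚ.∣ p ∣ ℚ.< ε) (sym (ℚₚ.+-identityʳ (seq x n ℚ.- seq y n))) (h n N≤n)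

p*p≥0 : ∀ p → 0ℚ ℚ.≤ p ℚ.* p
p*p≥0 p with ℚₚ.≤-total 0ℚ p
... | inj₁ 0≤p = Rational.*-nonNeg 0≤p 0≤p
... | inj₂ p≤0 = subst (0ℚ ℚ.≤_) (solve 1 (λ p → (:- p) :* (:- p) := p :* p) refl p)
  (Rational.*-nonNeg (ℚₚ.neg-antimono-≤ p≤0) (ℚₚ.neg-antimono-≤ p≤0))
  where open +-*-Solver

-- Truncations of the series can be negative at negative arguments, so the sign is obtained from the
-- square of exp (x/2).
exp-nonNeg : ∀ x → 0ℝ ≤ exp x
exp-nonNeg x = begin
  0ℝ                 ≤⟨ ≤-pointwise {0ℝ} {exp h * exp h} (λ n → p*p≥0 (seq (exp h) n)) ⟩
  exp h * exp h      ≈⟨ ≃-sym {exp (h + h)} {exp h * exp h} (exp-+ h h) ⟩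
  exp (h + h)        ≈⟨ exp-pointwise {h + h} {x} (λ n → ½+½ (seq x n)) ⟩
  exp x              ∎
  where
  open ≤-Reasoning
  h = fromℚ ½ * x

1+x≤exp : ∀ {x} → 0ℝ ≤ x → 1ℝ + x ≤ exp x
1+x≤exp {x} 0≤x = begin
  1ℝ + x        ≈⟨ +-cong {1ℝ} {1ℝ} {x} {∣ x ∣} (≃-refl {1ℝ}) (nonNeg⇒≃∣∣ {x} 0≤x) ⟩
  -- The approximant at index 0 is the constant 1 and lacks the linear term, so the comparison
  -- starts at index 1.
  1ℝ + ∣ x ∣    ≤⟨ ≤-eventually {1ℝ + ∣ x ∣} {exp ∣ x ∣} 1 (λ where
                     (suc n) _ → Series.1+q≤partialExp (ℚₚ.0≤∣p∣ (seq x (suc n))) n) ⟩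
  exp ∣ x ∣     ≈⟨ exp-cong {∣ x ∣} {x} (≃-sym {x} {∣ x ∣} (nonNeg⇒≃∣∣ {x} 0≤x)) ⟩
  exp x         ∎
  where open ≤-Reasoning

exp≤1+x*exp : ∀ {x} → 0ℝ ≤ x → exp x ≤ 1ℝ + x * exp x
exp≤1+x*exp {x} 0≤x = begin
  exp x                    ≈⟨ exp-cong {x} {∣ x ∣} x≃∣x∣ ⟩
  exp ∣ x ∣                ≤⟨ ≤-pointwise {exp ∣ x ∣} {1ℝ + ∣ x ∣ * exp ∣ x ∣} (λ n →
                                Series.partialExp≤1+q*partialExp (ℚₚ.0≤∣p∣ (seq x n)) n) ⟩
  1ℝ + ∣ x ∣ * exp ∣ x ∣   ≈⟨ +-cong {1ℝ} {1ℝ} {∣ x ∣ * exp ∣ x ∣} {x * exp x} (≃-refl {1ℝ})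
                                (≃-trans {∣ x ∣ * exp ∣ x ∣} {x * exp ∣ x ∣} {x * exp x}
                                  (*-congʳ (exp ∣ x ∣) {∣ x ∣} {x} (≃-sym {x} {∣ x ∣} x≃∣x∣))
                                  (*-congˡ x {exp ∣ x ∣} {exp x} (exp-cong {∣ x ∣} {x} (≃-sym {x} {∣ x ∣} x≃∣x∣)))) ⟩
  1ℝ + x * exp x           ∎
  where
  open ≤-Reasoning
  x≃∣x∣ = nonNeg⇒≃∣∣ {x} 0≤x

reciprocal : ∀ c → ∃[ N ] (∀ n → N ℕ.≤ n → ½ ℚ.≤ seq c n) → ℝ
reciprocal c (N , ½≤c) = mkℝ (λ n → Series.recip (seq c n)) λ ε 0<ε →
  let δ , 0<δ , 4δ<ε = shrink 4 0<ε
      M , h = cauchy c δ 0<δ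
  in M ℕ.⊔ N , λ m n ≤m ≤n → ℚₚ.≤-<-trans
       (ℚₚ.≤-trans (Series.recip-lipschitz
           (½≤c m (ℕₚ.m⊔n≤o⇒n≤o M N ≤m)) (½≤c n (ℕₚ.m⊔n≤o⇒n≤o M N ≤n)))
         (Rational.*-monoˡ (ℕ⇒ℚ 4) (Rational.0≤ℕ⇒ℚ 4)
           (ℚₚ.<⇒≤ (h m n (ℕₚ.m⊔n≤o⇒m≤o M N ≤m) (ℕₚ.m⊔n≤o⇒m≤o M N ≤n))))) 4δ<ε

-- Telescoping of errors over a partition

split-error : ∀ h s a b c k → (h + s) - (a - c) * k ≃ (h - (a - b) * k) + (s - (b - c) * k)
split-error h s a b c k = ≃-pointwise {(h + s) - (a - c) * k} {(h - (a - b) * k) + (s - (b - c) * k)} λ n →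
  solve 6 (λ h s a b c k → (h :+ s) :+ :- ((a :+ :- c) :* k) :=
    (h :+ :- ((a :+ :- b) :* k)) :+ (s :+ :- ((b :+ :- c) :* k))) refl
    (seq h n) (seq s n) (seq a n) (seq b n) (seq c n) (seq k n)
  where open +-*-Solver

join-bounds : ∀ a b c k → (a - b) * k + (b - c) * k ≃ (a - c) * k
join-bounds a b c k = ≃-pointwise {(a - b) * k + (b - c) * k} {(a - c) * k} λ n →
  solve 4 (λ a b c k → (a :+ :- b) :* k :+ (b :+ :- c) :* k := (a :+ :- c) :* k) refl
    (seq a n) (seq b n) (seq c n) (seq k n)
  where open +-*-Solver

no-error : ∀ a k δ → ∣ 0ℝ - (a - a) * k ∣ ≤ (a - a) * δ
no-error a k δ = ≤-reflexive {∣ 0ℝ - (a - a) * k ∣} {(a - a) * δ}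
  (≃-pointwise {∣ 0ℝ - (a - a) * k ∣} {(a - a) * δ} λ n →
    let a-a≡0 = ℚₚ.+-inverseʳ (seq a n) in
    trans (cong (λ b → ℚ.∣ 0ℚ ℚ.- b ℚ.* seq k n ∣) a-a≡0)
    (trans (cong (λ b → ℚ.∣ 0ℚ ℚ.- b ∣) (ℚₚ.*-zeroˡ (seq k n)))
    (trans (sym (ℚₚ.*-zeroˡ (seq δ n))) (cong (ℚ._* seq δ n) (sym a-a≡0)))))

+-errors : ∀ h s a b c k δ → ∣ h - (a - b) * k ∣ ≤ (a - b) * δ → ∣ s - (b - c) * k ∣ ≤ (b - c) * δ →
           ∣ (h + s) - (a - c) * k ∣ ≤ (a - c) * δ
+-errors h s a b c k δ h-error s-error = begin
  ∣ (h + s) - (a - c) * k ∣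
    ≈⟨ ∣∣-cong {(h + s) - (a - c) * k} {(h - (a - b) * k) + (s - (b - c) * k)} (split-error h s a b c k) ⟩
  ∣ (h - (a - b) * k) + (s - (b - c) * k) ∣
    ≤⟨ ∣∣-+ (h - (a - b) * k) (s - (b - c) * k) ⟩
  ∣ h - (a - b) * k ∣ + ∣ s - (b - c) * k ∣
    ≤⟨ +-mono-≤ {∣ h - (a - b) * k ∣} {(a - b) * δ} {∣ s - (b - c) * k ∣} {(b - c) * δ} h-error s-error ⟩
  (a - b) * δ + (b - c) * δ
    ≈⟨ join-bounds a b c δ ⟩
  (a - c) * δ ∎
  where open ≤-Reasoning

-- The exact strip values and the error bounds are both fixed multiples of the drops of `a`, so both
-- telescope and the number of strips does not enter.
sum-errors : ∀ k δ n (F : Fin n → ℝ) (a : Fin (suc n) → ℝ) →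
  (∀ i → ∣ F i - (a (inject₁ i) - a (Fin.suc i)) * k ∣ ≤ (a (inject₁ i) - a (Fin.suc i)) * δ) →
  ∣ sum F - (a Fin.zero - a (fromℕ n)) * k ∣ ≤ (a Fin.zero - a (fromℕ n)) * δ
sum-errors k δ zero F a errors = no-error (a Fin.zero) k δ
sum-errors k δ (suc n) F a errors =
  +-errors (F Fin.zero) (sum (F ∘ Fin.suc)) (a Fin.zero) (a (Fin.suc Fin.zero)) (a (fromℕ (suc n))) k δ
    (errors Fin.zero) (sum-errors k δ n (F ∘ Fin.suc) (a ∘ Fin.suc) (errors ∘ Fin.suc))

-- The integral of a decaying exponential

module ExponentialDecay (d c : ℝ) where

  f : ℝ → ℝ
  f l = exp (d - l * c)

  -- The antiderivative of f is -κ f.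
  module Integral (κ : ℝ) (0≤c : 0ℝ ≤ c) (0≤κ : 0ℝ ≤ κ) (c*κ≃1 : c * κ ≃ 1ℝ) where

    open +-*-Solver

    integral : ℝ → ℝ → ℝ
    integral u v = (f u - f v) * κ

    f-cong : ∀ {u v} → u ≃ v → f u ≃ f v
    f-cong {u} {v} u≃v = exp-cong {d - u * c} {d - v * c} (+-cong {d} {d} { - (u * c)} { - (v * c)}
      (≃-refl {d}) (neg-cong {u * c} {v * c} (*-congʳ c {u} {v} u≃v)))

    c*κ*x≃x : ∀ {x} → (c * κ) * x ≃ x
    c*κ*x≃x {x} = ≃-trans {(c * κ) * x} {1ℝ * x} {x} (*-congʳ x {c * κ} {1ℝ} c*κ≃1)
      (≃-pointwise {1ℝ * x} {x} λ n → ℚₚ.*-identityˡ (seq x n))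

    module _ {u v : ℝ} (u≤v : u ≤ v) where

      private
        w = v - u
        g = c * w

        0≤w : 0ℝ ≤ w
        0≤w = 0≤y-x {u} {v} u≤v

        0≤g : 0ℝ ≤ g
        0≤g = *-nonNeg {c} {w} 0≤c 0≤w

      f-shift : f u ≃ f v * exp g
      f-shift = ≃-trans {f u} {exp ((d - v * c) + g)} {f v * exp g}
        (exp-pointwise {d - u * c} {(d - v * c) + g} λ n →
          solve 4 (λ d u v c → d :+ :- (u :* c) := (d :+ :- (v :* c)) :+ c :* (v :+ :- u)) refl
            (seq d n) (seq u n) (seq v n) (seq c n))
        (exp-+ (d - v * c) g)

      -- Together with `f-drop≤` this plays the role of the mean value theorem: the drop of f over
      -- the strip lies between c w times its values at the right and the left end.
      f-drop≥ : f v * g ≤ f u - f v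
      f-drop≥ = begin
        f v * g
          ≈⟨ ≃-pointwise {f v * g} {f v * (1ℝ + g) - f v} (λ n →
               trans (solve 3 (λ o f g → f :* g := f :* (o :+ g) :+ :- (f :* o)) refl 1ℚ (seq (f v) n) (seq g n))
                 (cong (λ t → seq (f v * (1ℝ + g)) n ℚ.- t) (ℚₚ.*-identityʳ (seq (f v) n)))) ⟩
        f v * (1ℝ + g) - f v
          ≤⟨ +-mono-≤ {f v * (1ℝ + g)} {f v * exp g} { - f v} { - f v}
               (*-monoˡ-≤ (f v) {1ℝ + g} {exp g} (exp-nonNeg (d - v * c)) (1+x≤exp {g} 0≤g))
               (≤-reflexive { - f v} { - f v} (≃-refl { - f v})) ⟩
        f v * exp g - f v
          ≈⟨ +-cong {f v * exp g} {f u} { - f v} { - f v} (≃-sym {f u} {f v * exp g} f-shift) (≃-refl { - f v}) ⟩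
        f u - f v ∎
        where open ≤-Reasoning

      f-drop≤ : f u - f v ≤ f u * g
      f-drop≤ = begin
        f u - f v
          ≈⟨ +-cong {f u} {f v * exp g} { - f v} { - f v} f-shift (≃-refl { - f v}) ⟩
        f v * exp g - f v
          ≤⟨ +-mono-≤ {f v * exp g} {f v * (1ℝ + g * exp g)} { - f v} { - f v}
               (*-monoˡ-≤ (f v) {exp g} {1ℝ + g * exp g} (exp-nonNeg (d - v * c)) (exp≤1+x*exp {g} 0≤g))
               (≤-reflexive { - f v} { - f v} (≃-refl { - f v})) ⟩
        f v * (1ℝ + g * exp g) - f v
          ≈⟨ ≃-pointwise {f v * (1ℝ + g * exp g) - f v} {(f v * exp g) * g} (λ n →
               trans (cong (λ t → seq (f v * (1ℝ + g * exp g)) n ℚ.- t) (sym (ℚₚ.*-identityʳ (seq (f v) n))))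
                 (solve 4 (λ o f g e → f :* (o :+ g :* e) :+ :- (f :* o) := (f :* e) :* g) refl
                   1ℚ (seq (f v) n) (seq g n) (seq (exp g) n))) ⟩
        (f v * exp g) * g
          ≈⟨ *-congʳ g {f v * exp g} {f u} (≃-sym {f u} {f v * exp g} f-shift) ⟩
        f u * g ∎
        where open ≤-Reasoning

      f-antitone : f v ≤ f u
      f-antitone = begin
        f v
          ≈⟨ ≃-pointwise {f v} {0ℝ + f v} (λ n → sym (ℚₚ.+-identityˡ (seq (f v) n))) ⟩
        0ℝ + f v
          ≤⟨ +-mono-≤ {0ℝ} {f u - f v} {f v} {f v}
               (≤-trans {0ℝ} {f v * g} {f u - f v} (*-nonNeg {f v} {g} (exp-nonNeg (d - v * c)) 0≤g) f-drop≥)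
               (≤-reflexive {f v} {f v} (≃-refl {f v})) ⟩
        (f u - f v) + f v
          ≈⟨ ≃-pointwise {(f u - f v) + f v} {f u} (λ n →
               solve 2 (λ a b → (a :+ :- b) :+ b := a) refl (seq (f u) n) (seq (f v) n)) ⟩
        f u ∎
        where open ≤-Reasoning

      *g*κ≃*w : ∀ {x} → (x * g) * κ ≃ x * w
      *g*κ≃*w {x} = ≃-trans {(x * g) * κ} {(c * κ) * (x * w)} {x * w}
        (≃-pointwise {(x * g) * κ} {(c * κ) * (x * w)} λ n →
          solve 4 (λ x c w k → (x :* (c :* w)) :* k := (c :* k) :* (x :* w)) refl
            (seq x n) (seq c n) (seq w n) (seq κ n))
        (c*κ*x≃x {x * w})

      integral≥ : f v * w ≤ integral u v
      integral≥ = begin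
        f v * w         ≈⟨ ≃-sym {(f v * g) * κ} {f v * w} (*g*κ≃*w {f v}) ⟩
        (f v * g) * κ   ≤⟨ *-monoʳ-≤ κ {f v * g} {f u - f v} 0≤κ f-drop≥ ⟩
        integral u v    ∎
        where open ≤-Reasoning

      integral≤ : integral u v ≤ f u * w
      integral≤ = begin
        integral u v    ≤⟨ *-monoʳ-≤ κ {f u - f v} {f u * g} 0≤κ f-drop≤ ⟩
        (f u * g) * κ   ≈⟨ *g*κ≃*w {f u} ⟩
        f u * w         ∎
        where open ≤-Reasoning

    module _ {δ : ℝ} where

      -- The rectangle at the tag and the strip integral both lie between the rectangles of heights
      -- f v and f u, hence differ by at most the drop times the width.
      strip-error : ∀ {u t v} → u ≤ t → t ≤ v → v - u < δ →
                    ∣ f t * (v - u) - integral u v ∣ ≤ (f u - f v) * δ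
      strip-error {u} {t} {v} u≤t t≤v w<δ = begin
        ∣ f t * w - I ∣
          ≤⟨ ∣∣-least {f t * w - I} {f u * w - f v * w}
               (+-mono-≤ {f t * w} {f u * w} { - I} { - (f v * w)}
                 (*-monoʳ-≤ w {f t} {f u} 0≤w (f-antitone {u} {t} u≤t))
                 (neg-antimono-≤ {f v * w} {I} (integral≥ {u} {v} u≤v)))
               below ⟩
        f u * w - f v * w
          ≈⟨ ≃-pointwise {f u * w - f v * w} {(f u - f v) * w} (λ n →
               solve 3 (λ a b w → a :* w :+ :- (b :* w) := (a :+ :- b) :* w) refl
                 (seq (f u) n) (seq (f v) n) (seq w n)) ⟩
        (f u - f v) * w
          ≤⟨ *-monoˡ-≤ (f u - f v) {w} {δ} (0≤y-x {f v} {f u} (f-antitone {u} {v} u≤v)) (<⇒≤ {w} {δ} w<δ) ⟩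
        (f u - f v) * δ ∎
        where
        open ≤-Reasoning
        w = v - u
        I = integral u v
        u≤v = ≤-trans {u} {t} {v} u≤t t≤v
        0≤w = 0≤y-x {u} {v} u≤v
        below : - (f t * w - I) ≤ f u * w - f v * w
        below = begin
          - (f t * w - I)
            ≈⟨ ≃-pointwise { - (f t * w - I)} {I - f t * w} (λ n →
                 solve 2 (λ a b → :- (a :+ :- b) := b :+ :- a) refl (seq (f t * w) n) (seq I n)) ⟩
          I - f t * w
            ≤⟨ +-mono-≤ {I} {f u * w} { - (f t * w)} { - (f v * w)} (integral≤ {u} {v} u≤v)
                 (neg-antimono-≤ {f v * w} {f t * w} (*-monoʳ-≤ w {f v} {f t} 0≤w (f-antitone {t} {v} t≤v))) ⟩
          f u * w - f v * w ∎

    integral-cong : ∀ {u u′ v v′} → u ≃ u′ → v ≃ v′ → integral u v ≃ integral u′ v′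
    integral-cong {u} {u′} {v} {v′} u≃ v≃ = *-congʳ κ {f u - f v} {f u′ - f v′}
      (+-cong {f u} {f u′} { - f v} { - f v′} (f-cong {u} {u′} u≃) (neg-cong {f v} {f v′} (f-cong {v} {v′} v≃)))

    hasIntegral : ∀ a b → HasIntegral f a b (integral a b)
    hasIntegral a b ε 0<ε =
      -- The total drop is at most f a ≤ B because f is nonnegative at the right end. A mesh η
      -- therefore gives an error of at most B η.
      let B , fa≤B = ≤-ℕ⇒ℝ (f a)
          η , 0<η , Bη<ε = shrink B (proj₁ (proj₂ 0<ε))
          δ = fromℚ η
      in δ , fromℚ-< 0<η , λ P w<δ →
        let open TaggedPartition P
            R = riemannSum f
            u = point Fin.zero
            v = point (fromℕ size)
            open ≤-Reasoning
        in ≤-<-trans {∣ R - integral a b ∣} {fromℚ (ℕ⇒ℚ B ℚ.* η)} {ε} (begin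
          ∣ R - integral a b ∣
            ≈⟨ ∣∣-cong {R - integral a b} {R - integral u v} (+-cong {R} {R} { - integral a b} { - integral u v}
                 (≃-refl {R}) (neg-cong {integral a b} {integral u v}
                   (integral-cong {a} {u} {b} {v} (≃-sym {u} {a} first) (≃-sym {v} {b} last)))) ⟩
          ∣ R - integral u v ∣
            ≤⟨ sum-errors κ δ size (λ i → f (tag i) * width i) (λ i → f (point i)) (λ i →
                 strip-error {δ} {point (inject₁ i)} {tag i} {point (Fin.suc i)}
                   (proj₁ (tagged i)) (proj₂ (tagged i)) (w<δ i)) ⟩
          (f u - f v) * δ
            ≤⟨ *-monoʳ-≤ δ {f u - f v} {ℕ⇒ℝ B} (<⇒≤ {0ℝ} {δ} (fromℚ-< 0<η)) (begin
                 f u - f v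
                   ≤⟨ +-mono-≤ {f u} {f u} { - f v} {0ℝ} (≤-reflexive {f u} {f u} (≃-refl {f u}))
                        (neg-antimono-≤ {0ℝ} {f v} (exp-nonNeg (d - v * c))) ⟩
                 f u + 0ℝ
                   ≈⟨ ≃-pointwise {f u + 0ℝ} {f u} (λ n → ℚₚ.+-identityʳ (seq (f u) n)) ⟩
                 f u
                   ≈⟨ f-cong {u} {a} first ⟩
                 f a
                   ≤⟨ fa≤B ⟩
                 ℕ⇒ℝ B ∎) ⟩
          ℕ⇒ℝ B * δ
            ≈⟨ ≃-pointwise {ℕ⇒ℝ B * δ} {fromℚ (ℕ⇒ℚ B ℚ.* η)} (λ _ → refl) ⟩
          fromℚ (ℕ⇒ℚ B ℚ.* η) ∎)
          (fromℚ-between {ε} 0<ε Bη<ε)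

    fκ : ℝ → ℝ
    fκ l = f l * κ

    -- The rectangle of height f b over [0 , b] fits under the integral, which is at most f 0 κ.
    -- This bounds the tail f b κ by a multiple of 1/b, enough for convergence.
    f-decay : ∀ b → 0ℝ ≤ b → fκ b * b ≤ fκ 0ℝ * κ
    f-decay b 0≤b = begin
      fκ b * b
        ≈⟨ ≃-pointwise {fκ b * b} {(f b * (b - 0ℝ)) * κ} (λ n →
             trans (solve 3 (λ f k b → (f :* k) :* b := (f :* b) :* k) refl (seq (f b) n) (seq κ n) (seq b n))
               (cong (λ t → (seq (f b) n ℚ.* t) ℚ.* seq κ n) (sym (ℚₚ.+-identityʳ (seq b n))))) ⟩
      (f b * (b - 0ℝ)) * κ
        ≤⟨ *-monoʳ-≤ κ {f b * (b - 0ℝ)} {integral 0ℝ b} 0≤κ (integral≥ {0ℝ} {b} 0≤b) ⟩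
      integral 0ℝ b * κ
        ≤⟨ *-monoʳ-≤ κ {integral 0ℝ b} {fκ 0ℝ} 0≤κ (*-monoʳ-≤ κ {f 0ℝ - f b} {f 0ℝ} 0≤κ (begin
             f 0ℝ - f b
               ≤⟨ +-mono-≤ {f 0ℝ} {f 0ℝ} { - f b} {0ℝ} (≤-reflexive {f 0ℝ} {f 0ℝ} (≃-refl {f 0ℝ}))
                    (neg-antimono-≤ {0ℝ} {f b} (exp-nonNeg (d - b * c))) ⟩
             f 0ℝ + 0ℝ
               ≈⟨ ≃-pointwise {f 0ℝ + 0ℝ} {f 0ℝ} (λ n → ℚₚ.+-identityʳ (seq (f 0ℝ) n)) ⟩
             f 0ℝ ∎)) ⟩
      fκ 0ℝ * κ ∎
      where open ≤-Reasoning

    fκ-small : ∀ {B D η} → 0ℚ ℚ.< η → 1ℚ ℚ.≤ ℕ⇒ℚ D ℚ.* η → fκ 0ℝ * κ ≤ ℕ⇒ℝ B →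
               ∀ b → 0ℝ ≤ b → ℕ⇒ℝ D ≤ b → fκ b ≤ fromℚ (ℕ⇒ℚ B ℚ.* η)
    fκ-small {B} {D} {η} 0<η 1≤Dη Q≤B b 0≤b D≤b = begin
      fκ b
        ≈⟨ ≃-pointwise {fκ b} {fκ b * 1ℝ} (λ n → sym (ℚₚ.*-identityʳ (seq (fκ b) n))) ⟩
      fκ b * 1ℝ
        ≤⟨ *-monoˡ-≤ (fκ b) {1ℝ} {ℕ⇒ℝ D * fromℚ η} 0≤fκ
             (≤-pointwise {1ℝ} {ℕ⇒ℝ D * fromℚ η} λ _ → 1≤Dη) ⟩
      fκ b * (ℕ⇒ℝ D * fromℚ η)
        ≈⟨ ≃-pointwise {fκ b * (ℕ⇒ℝ D * fromℚ η)} {(fκ b * ℕ⇒ℝ D) * fromℚ η} (λ n →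
             sym (ℚₚ.*-assoc (seq (fκ b) n) (ℕ⇒ℚ D) η)) ⟩
      (fκ b * ℕ⇒ℝ D) * fromℚ η
        ≤⟨ *-monoʳ-≤ (fromℚ η) {fκ b * ℕ⇒ℝ D} {ℕ⇒ℝ B} (<⇒≤ {0ℝ} {fromℚ η} (fromℚ-< 0<η)) (begin
             fκ b * ℕ⇒ℝ D   ≤⟨ *-monoˡ-≤ (fκ b) {ℕ⇒ℝ D} {b} 0≤fκ D≤b ⟩
             fκ b * b       ≤⟨ f-decay b 0≤b ⟩
             fκ 0ℝ * κ      ≤⟨ Q≤B ⟩
             ℕ⇒ℝ B          ∎) ⟩
      ℕ⇒ℝ B * fromℚ η
        ≈⟨ ≃-pointwise {ℕ⇒ℝ B * fromℚ η} {fromℚ (ℕ⇒ℚ B ℚ.* η)} (λ _ → refl) ⟩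
      fromℚ (ℕ⇒ℚ B ℚ.* η) ∎
      where
      open ≤-Reasoning
      0≤fκ = *-nonNeg {f b} {κ} (exp-nonNeg (d - b * c)) 0≤κ

    integral-tail : ∀ {v} → v ≃ fκ 0ℝ → ∀ b → ∣ integral 0ℝ b - v ∣ ≃ fκ b
    integral-tail {v} v≃ b = begin-equality
      ∣ integral 0ℝ b - v ∣
        ≈⟨ ∣∣-cong {integral 0ℝ b - v} {integral 0ℝ b - fκ 0ℝ}
             (+-cong {integral 0ℝ b} {integral 0ℝ b} { - v} { - fκ 0ℝ} (≃-refl {integral 0ℝ b})
               (neg-cong {v} {fκ 0ℝ} v≃)) ⟩
      ∣ integral 0ℝ b - fκ 0ℝ ∣
        ≈⟨ ≃-pointwise {∣ integral 0ℝ b - fκ 0ℝ ∣} {∣ fκ b ∣} (λ n →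
             trans (cong ℚ.∣_∣ (solve 3 (λ a b k → (a :+ :- b) :* k :+ :- (a :* k) := :- (b :* k)) refl
               (seq (f 0ℝ) n) (seq (f b) n) (seq κ n))) (ℚₚ.∣-p∣≡∣p∣ (seq (fκ b) n))) ⟩
      ∣ fκ b ∣
        ≈⟨ ≃-sym {fκ b} {∣ fκ b ∣} (nonNeg⇒≃∣∣ {fκ b}
             (*-nonNeg {f b} {κ} (exp-nonNeg (d - b * c)) 0≤κ)) ⟩
      fκ b ∎
      where open ≤-Reasoning

    fκ0≃ : fκ 0ℝ ≃ exp d * κ
    fκ0≃ = *-congʳ κ {f 0ℝ} {exp d} (exp-pointwise {d - 0ℝ * c} {d} λ n →
      trans (cong (λ p → seq d n ℚ.- p) (ℚₚ.*-zeroˡ (seq c n))) (ℚₚ.+-identityʳ (seq d n)))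

    hasImproperIntegral : ∀ {v} → v ≃ fκ 0ℝ → HasImproperIntegral f 0ℝ v
    hasImproperIntegral {v} v≃ = integral 0ℝ , (λ b _ → hasIntegral 0ℝ b) , λ ε 0<ε →
      let B , Q≤B = ≤-ℕ⇒ℝ (fκ 0ℝ * κ)
          η , 0<η , Bη<ε = shrink B (proj₁ (proj₂ 0<ε))
          D , 1≤Dη = Series.archimedean 0<η
      in ℕ⇒ℝ D , λ b 0≤b D≤b →
        ≤-<-trans {∣ integral 0ℝ b - v ∣} {fromℚ (ℕ⇒ℚ B ℚ.* η)} {ε}
          (≤-trans {∣ integral 0ℝ b - v ∣} {fκ b} {fromℚ (ℕ⇒ℚ B ℚ.* η)}
            (≤-reflexive {∣ integral 0ℝ b - v ∣} {fκ b} (integral-tail {v} v≃ b))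
            (fκ-small {B} {D} {η} 0<η 1≤Dη Q≤B b 0≤b D≤b))
          (fromℚ-between {ε} 0<ε Bη<ε)

    hasImproperIntegral-exp : HasImproperIntegral f 0ℝ (exp d * κ)
    hasImproperIntegral-exp = hasImproperIntegral {exp d * κ} (≃-sym {fκ 0ℝ} {exp d * κ} fκ0≃)

-- From approximants to real sums

module RationalSums = FiniteSums ℚ.+-*-rawSemiring
module RationalPowers = SemiringDefs ℚ.+-*-rawSemiring

seq-∑ : ∀ n (f : ℕ → ℝ) i → seq (∑≤ n f) i ≡ RationalSums.∑≤ n (λ k → seq (f k) i)
seq-∑ zero    f i = refl
seq-∑ (suc n) f i = cong (ℚ._+ seq (f (suc n)) i) (seq-∑ n f i)

seq-^ : ∀ x k i → seq (x ^ k) i ≡ seq x i RationalPowers.^ k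
seq-^ x zero    i = refl
seq-^ x (suc k) i = cong (seq x i ℚ.*_) (seq-^ x k i)

module _ (m : ℕ) .{{_ : NonZero m}} (a : ℝ) where

  seq-W̃ : ∀ n k i → seq (W̃ m a n k) i ≡ Series.whitney m (seq a i) n k
  seq-W̃ n k i = cong ((+ 1 ℚ./ (m ℕ.^ k ℕ.* k !)) {{m^k*k!≢0}} ℚ.*_)
    (trans (seq-∑ k _ i) (Series.∑-cong k λ j _ → cong₂ ℚ._*_
      (cong (ℕ⇒ℚ (k C j) ℚ.*_) (seq-^ (- 1ℝ) (k ∸ j) i)) (seq-^ (ℕ⇒ℝ (m ℕ.* j) - a) n i)))
    where
    m^k*k!≢0 : NonZero (m ℕ.^ k ℕ.* k !)
    m^k*k!≢0 = ℕₚ.m*n≢0 (m ℕ.^ k) (k !) {{ℕₚ.m^n≢0 m k}} {{k !≢0}}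

  seq-F̃ : ∀ n x i → seq (F̃ m a n x) i ≡ Series.tannyDowling m (seq a i) n (seq x i)
  seq-F̃ n x i = trans (seq-∑ n _ i) (Series.∑-cong n λ k _ → cong₂ ℚ._*_
    (cong (ℕ⇒ℚ (k !) ℚ.*_) (seq-W̃ n k i)) (seq-^ x k i))

-- For fixed n, the distance of two reals is decided by their late approximants. Hence a bound for i
-- ≥ n suffices, and that is where the truncations at degree i are long enough to be compared with
-- the partial sum up to n.
hasSum-geometric : ∀ {f s} G N → (∀ n i → N ℕ.≤ i → n ℕ.≤ i →
  ℚ.∣ RationalSums.∑≤ n (λ k → seq (f k) i) ℚ.- seq s i ∣ ℚ.≤ G ℚ.* ½ RationalPowers.^ n) → HasSum f s
hasSum-geometric {f} {s} G N error ε (δ , 0<δ , M , δ<ε) =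
  let K , small = Series.½^-small G (½-pos 0<δ)
  in K , λ n K≤n → ½ ℚ.* δ , ½-pos 0<δ , M ℕ.⊔ (N ℕ.⊔ n) , λ i ≤i →
    let N⊔n≤i = ℕₚ.m⊔n≤o⇒n≤o M (N ℕ.⊔ n) ≤i
        e = subst (λ p → ℚ.∣ p ℚ.- seq s i ∣ ℚ.< ½ ℚ.* δ) (sym (seq-∑ n f i))
              (ℚₚ.≤-<-trans (error n i (ℕₚ.m⊔n≤o⇒m≤o N n N⊔n≤i) (ℕₚ.m⊔n≤o⇒n≤o N n N⊔n≤i)) (small n K≤n))
    in ℚₚ.<-trans
         (subst (ℚ.∣ seq (∑≤ n f) i ℚ.- seq s i ∣ ℚ.+ ½ ℚ.* δ ℚ.<_) (½+½ δ) (ℚₚ.+-monoˡ-< (½ ℚ.* δ) e))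
         (subst (ℚ._< seq ε i) (ℚₚ.+-identityˡ δ) (δ<ε i (ℕₚ.m⊔n≤o⇒m≤o M (N ℕ.⊔ n) ≤i)))

-- The numbers u n are the coefficients of exp b / (1 - y (exp q - 1)), the powers of z being absorbed in q and b.
module GeneratingFunction (q b y : ℝ) (N : ℕ)
  (b≤½ : ∀ n → N ℕ.≤ n → ℚ.∣ seq b n ∣ ℚ.≤ ½)
  (q≤¼ : ∀ n → N ℕ.≤ n → ℚ.∣ seq q n ∣ ℚ.≤ Series.¼)
  (yq≤⅛ : ∀ n → N ℕ.≤ n → ℚ.∣ seq y n ℚ.* seq q n ∣ ℚ.≤ Series.⅛)
  (u : ℕ → ℝ) (seq-u : ∀ k i → seq (u k) i ≡ Series.coeff (seq q i) (seq b i) (seq y i) k)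
  where

  c : ℝ
  c = 1ℝ - y * (exp q - 1ℝ)

  -- The approximant at suc n involves the kernel summed up to n, which matches indices only from 1
  -- on; hence `suc N`.
  ½≤c : ∀ n → suc N ℕ.≤ n → ½ ℚ.≤ seq c n
  ½≤c (suc n) (ℕ.s≤s N≤n) = Series.½≤1-∑kernel {seq q (suc n)} {seq b (suc n)} {seq y (suc n)}
    (b≤½ (suc n) N≤1+n) (q≤¼ (suc n) N≤1+n) (yq≤⅛ (suc n) N≤1+n) n
    where N≤1+n = ℕₚ.m≤n⇒m≤1+n N≤n

  κ : ℝ
  κ = reciprocal c (suc N , ½≤c)

  0≤c : 0ℝ ≤ c
  0≤c = ≤-eventually {0ℝ} {c} (suc N) λ n N<n → ℚₚ.≤-trans (ℚₚ.nonNegative⁻¹ ½) (½≤c n N<n)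

  0≤κ : 0ℝ ≤ κ
  0≤κ = ≤-pointwise {0ℝ} {κ} λ n → Series.recip-nonNeg (seq c n)

  c*κ≃1 : c * κ ≃ 1ℝ
  c*κ≃1 = ≃-eventually {c * κ} {1ℝ} (suc N) λ n N<n → Series.recip-inverse (½≤c n N<n)

  ∑u-error : ∀ n i → suc N ℕ.≤ i → n ℕ.≤ i →
    ℚ.∣ RationalSums.∑≤ n (λ k → seq (u k) i) ℚ.- seq (exp b * κ) i ∣ ℚ.≤
    (ℕ⇒ℚ 3 ℚ.+ ℕ⇒ℚ 3) ℚ.* ½ RationalPowers.^ n
  ∑u-error n (suc i) N<i n≤i = ℚₚ.≤-trans
    (ℚₚ.≤-reflexive (cong (λ p → ℚ.∣ p ℚ.- seq (exp b * κ) (suc i) ∣) (Series.∑-cong n λ k _ → seq-u k (suc i))))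
    (Series.∑coeff-error {seq q (suc i)} {seq b (suc i)} {seq y (suc i)}
      (b≤½ (suc i) N≤i) (q≤¼ (suc i) N≤i) (yq≤⅛ (suc i) N≤i)
      {Series.recip (seq c (suc i))} {i} (Series.∣recip∣≤2 (seq c (suc i)))
      (Series.recip-inverse (½≤c (suc i) N<i))
      n n≤i)
    where N≤i = ℕₚ.<⇒≤ N<i

  hasSum : HasSum u (exp b * κ)
  hasSum = hasSum-geometric {u} {exp b * κ} (ℕ⇒ℚ 3 ℚ.+ ℕ⇒ℚ 3) (suc N) ∑u-error

  hasIntegral-f : HasImproperIntegral (ExponentialDecay.f b c) 0ℝ (exp b * κ)
  hasIntegral-f = ExponentialDecay.Integral.hasImproperIntegral-exp b c κ 0≤c 0≤κ c*κ≃1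

  sum-is-integral : ∃[ v ] (HasSum u v ×
    HasImproperIntegral (λ l → exp (b - l * (1ℝ - y * (exp q - 1ℝ)))) 0ℝ v)
  sum-is-integral = exp b * κ , hasSum ,
    -- The transports along `refl` unfold `f` and then `c`, giving the integrand the form required
    -- in the conclusion.
    subst (λ t → HasImproperIntegral (λ l → exp (b - l * t)) 0ℝ (exp b * κ)) {c} {1ℝ - y * (exp q - 1ℝ)} refl
      (subst (λ g → HasImproperIntegral g 0ℝ (exp b * κ)) {ExponentialDecay.f b c} {λ l → exp (b - l * c)} refl
        hasIntegral-f)

-- The generating function for small z

module _ {a x z : ℝ} {m : ℕ} .{{m≢0 : NonZero m}} {A X : ℕ} {δ : ℚ}
         (small : ℕ⇒ℚ (A ℕ.+ (m ℕ.+ X ℕ.* m)) ℚ.* δ ℚ.< Series.⅛) {N : ℕ}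
         (a≤A : ∀ n → N ℕ.≤ n → ℚ.∣ seq a n ∣ ℚ.≤ ℕ⇒ℚ A) (x≤X : ∀ n → N ℕ.≤ n → ℚ.∣ seq x n ∣ ℚ.≤ ℕ⇒ℚ X)
         (z≤δ : ∀ n → N ℕ.≤ n → ℚ.∣ seq z n ∣ ℚ.≤ δ) where

  az-bound : ∀ n → N ℕ.≤ n → ℚ.∣ seq (- (a * z)) n ∣ ℚ.≤ ½
  az-bound n N≤n =
    Series.az≤½ {m} {A} {X} {δ} {seq a n} {seq x n} {seq z n} small (a≤A n N≤n) (x≤X n N≤n) (z≤δ n N≤n)

  mz-bound : ∀ n → N ℕ.≤ n → ℚ.∣ seq (ℕ⇒ℝ m * z) n ∣ ℚ.≤ Series.¼
  mz-bound n N≤n =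
    Series.mz≤¼ {m} {A} {X} {δ} {seq a n} {seq x n} {seq z n} small (a≤A n N≤n) (x≤X n N≤n) (z≤δ n N≤n)

  xz-bound : ∀ n → N ℕ.≤ n → ℚ.∣ seq (x ÷ m) n ℚ.* seq (ℕ⇒ℝ m * z) n ∣ ℚ.≤ Series.⅛
  xz-bound n N≤n =
    Series.xz≤⅛ {m} {A} {X} {δ} {seq a n} {seq x n} {seq z n} small (a≤A n N≤n) (x≤X n N≤n) (z≤δ n N≤n)

  coeff-sum : ∀ {u : ℕ → ℝ} →
    (∀ k i → seq (u k) i ≡ Series.coeff (seq (ℕ⇒ℝ m * z) i) (seq (- (a * z)) i) (seq ((x ÷ m) {{m≢0}}) i) k) →
    ∃[ s ] (HasSum u s × HasImproperIntegral
      (λ l → exp (- (a * z) - l * (1ℝ - (x ÷ m) {{m≢0}} * (exp (ℕ⇒ℝ m * z) - 1ℝ)))) 0ℝ s)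
  coeff-sum {u} = GeneratingFunction.sum-is-integral (ℕ⇒ℝ m * z) (- (a * z)) ((x ÷ m) {{m≢0}}) N
    az-bound mz-bound xz-bound u

theorem7 : (a x : ℝ) (m : ℕ) .{{_ : NonZero m}} →
    ∃[ δ ] (0ℝ < δ × (∀ z → ∣ z ∣ < δ →
    ∃[ s ] (HasSum (λ n → F̃ m a n x * (z ^ n ÷ n !) {{n !≢0}}) s ×
    HasImproperIntegral
    (λ l → exp (- (a * z) - l * (1ℝ - (x ÷ m) * (exp (ℕ⇒ℝ m * z) - 1ℝ))))
    0ℝ s)))
theorem7 a x m {{m≢0}} =
  let A , M₁ , a≤A = bounded a
      X , M₂ , x≤X = bounded x
      -- The summands A, m and X m bound the coefficients of z in az, mz and (x/m)(mz), the last
      -- through the crude estimate 1/m ≤ 1. One inequality with ⅛ thus covers all three thresholds.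
      δ , 0<δ , small = shrink (A ℕ.+ (m ℕ.+ X ℕ.* m)) (ℚₚ.positive⁻¹ Series.⅛)
  in fromℚ δ , fromℚ-< 0<δ , λ z (ε , 0<ε , M₃ , ∣z∣+ε<δ) →
    coeff-sum {a} {x} {z} {m} {{m≢0}} {A} {X} {δ} small {M₁ ℕ.⊔ (M₂ ℕ.⊔ M₃)}
      (λ n N≤n → a≤A n (ℕₚ.m⊔n≤o⇒m≤o M₁ (M₂ ℕ.⊔ M₃) N≤n))
      (λ n N≤n → x≤X n (ℕₚ.m⊔n≤o⇒m≤o M₂ M₃ (ℕₚ.m⊔n≤o⇒n≤o M₁ (M₂ ℕ.⊔ M₃) N≤n)))
      (λ n N≤n → ℚₚ.≤-trans (Series.p≤p+q (ℚₚ.<⇒≤ 0<ε))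
        (ℚₚ.<⇒≤ (∣z∣+ε<δ n (ℕₚ.m⊔n≤o⇒n≤o M₂ M₃ (ℕₚ.m⊔n≤o⇒n≤o M₁ (M₂ ℕ.⊔ M₃) N≤n)))))
      (λ k i → trans (cong₂ ℚ._*_ (seq-F̃ m {{m≢0}} a k x i) (seq-expTerm z k i))
        (Series.tannyDowling*z^ m {{m≢0}} (seq a i) (seq x i) (seq z i) k))
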